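{- Consider the generalized box-ball system with box capacities $\delta_j\ge1$ ($j\in\mathbf{Z}$) and finitely many balls with colors in $\{1,\dots,n\}$. For a state $s$ let $(P(s),Q(s))$ be the pair of tableaux attached to $s$ by the RSK correspondence, and let $T(s)$ be the state after one step of time evolution. Then: (1) $P(T(s))=P(s)$; (2) the $Q$-symbol evolves independently of the $P$-symbol: if $Q(s_1)=Q(s_2)$ then $Q(T(s_1))=Q(T(s_2))$; (3) the time evolution of the $Q$-symbol is given by the box-label algorithm: with $N$ the number of balls of $s$ and $C$ the initial carrier defined below, the carrier algorithm applied to the word $W(Q(s))$ with initial carrier $C$ outputs $W(Q(T(s)))$.
   Context: Generalized BBS: boxes indexed by $\mathbf{Z}$; box $j$ has capacity $\delta_j\ge 1$; a state places finitely many balls, each of a color in $\{1,\dots,n\}$, so that box $j$ contains at most $\delta_j$ balls (balls in a box are unordered). One time step: every ball is moved exactly once; for $c=1,2,\dots,n$ in this order, repeatedly take the leftmost (in box order) not-yet-moved ball of color $c$ and move it to the nearest box strictly to its right that currently contains fewer balls than its capacity, until all balls of color $c$ have been moved. Bi-word and RSK: list the balls as pairs (box label, color), sorted lexicographically (by box label, then by color), giving columns $\binom{j_1}{c_1},\dots,\binom{j_N}{c_N}$. $P(s)$ is obtained by successively row-inserting (Schensted bumping) $c_1,\dots,c_N$ into the empty tableau; $Q(s)$ is the tableau of the same shape obtained by writing $j_k$ in the box newly created at the $k$-th insertion. Row insertion of $x$: if no entry of the first row is larger than $x$, append $x$; otherwise replace the leftmost entry larger than $x$ by $x$ and insert the replaced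 entry into the next row likewise. For a tableau $T$, $W(T)$ is the word obtained by reading rows left to right, from the bottom row up to the top row. Slots and initial carrier: choose integers $\cdots<d_{j-1}<d_j<\cdots$ with $d_j-d_{j-1}=\delta_j$; box $j$ consists of slots $d_{j-1}+1,\dots,d_j$, each slot $i$ carries the box label $l_i=j$. In a state, the balls of box $j$ occupy its rightmost slots (empty slots packed to the left). Let $p$ be the smallest occupied slot and $q$ the largest occupied slot plus $N$. The initial carrier $C$ is the weakly increasing sequence $(l_i : i\in[p,q],\ \text{slot } i \text{ empty})$. Carrier algorithm: given a weakly increasing carrier $C_0=C$ and a word $w=(w_1,\dots,w_M)$, for $k=1,\dots,M$: if $C_{k-1}$ contains numbers strictly larger than $w_k$, let $w'_k$ be the smallest of them, else $w'_k=\min C_{k-1}$; $C_k$ is $C_{k-1}$ with one copy of $w'_k$ replaced by $w_k$. The output word is $(w'_1,\dots,w'_M)$. -}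

module Defs where

open import Data.Bool using (Bool; true; false; if_then_else_; _∧_; _∨_; not)
open import Data.Nat as ℕ using (ℕ; zero; suc)
open import Data.Integer as ℤ using (ℤ; +_; _+_; _-_; _⊓_; _⊔_)
open import Data.Product using (_×_; _,_; proj₁; proj₂)
open import Data.Maybe using (Maybe; just; nothing)
open import Data.List using (List; []; _∷_; _++_; [_]; length; filter; map; concat; concatMap; foldl; reverse; upTo; applyUpTo)
open import Relation.Nullary.Decidable using (does)
open import Relation.Binary.PropositionalEquality using (_≡_)
open import Data.List.Membership.Propositional using (_∈_)
import Data.Bool as B

-- A ball is a pair (box label, color).  A state is a finite list of balls,
-- considered as a multiset (all derived objects below are invariant under
-- permuting the list, since the bi-word is obtained by sorting).
Ball : Set
Ball = ℤ × ℕ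

State : Set
State = List Ball

occ : State → ℤ → ℕ
occ s j = length (filter (λ b → proj₁ b ℤ.≟ j) s)

record ValidState (n : ℕ) (δ : ℤ → ℕ) (s : State) : Set where
  field
    colorsOk   : ∀ {j c} → (j , c) ∈ s → (1 ℕ.≤ c) × (c ℕ.≤ n)
    capacityOk : ∀ j → occ s j ℕ.≤ δ j

nearest : (δ : ℤ → ℕ) → State → ℕ → ℤ → ℤ
nearest δ s zero k = k
nearest δ s (suc f) k = if does (occ s k ℕ.<? δ k) then k else nearest δ s f (k + + 1)

minBoxOfColor : ℕ → State → Maybe ℤ
minBoxOfColor c [] = nothing
minBoxOfColor c ((j , d) ∷ s) with minBoxOfColor c s | does (d ℕ.≟ c)
... | r        | false = r
... | nothing  | true  = just j
... | just j'  | true  = just (j ⊓ j')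

removeOne : Ball → State → State
removeOne b [] = []
removeOne (j , c) ((j' , c') ∷ s) =
  if does (j ℤ.≟ j') ∧ does (c ℕ.≟ c') then s else (j' , c') ∷ removeOne (j , c) s

-- move all not-yet-moved balls of color c (U = unmoved, M = moved),
-- leftmost first; fuel bounds the number of moves
moveColor : (δ : ℤ → ℕ) → ℕ → ℕ → State × State → State × State
moveColor δ zero c UM = UM
moveColor δ (suc f) c (U , M) with minBoxOfColor c U
... | nothing = (U , M)
... | just j  =
  let U' = removeOne (j , c) U
      k  = nearest δ (U' ++ M) (suc (length (U ++ M))) (j + + 1)
  in moveColor δ f c (U' , (k , c) ∷ M)

T : (n : ℕ) → (δ : ℤ → ℕ) → State → State
T n δ s = proj₂ (foldl (λ UM c → moveColor δ (length (proj₁ UM)) c UM)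
                       (s , []) (applyUpTo suc n))

lexLeq : Ball → Ball → Bool
lexLeq (j , c) (j' , c') = does (j ℤ.<? j') ∨ (does (j ℤ.≟ j') ∧ does (c ℕ.≤? c'))

insertSorted : Ball → List Ball → List Ball
insertSorted b [] = [ b ]
insertSorted b (b' ∷ bs) = if lexLeq b b' then b ∷ b' ∷ bs else b' ∷ insertSorted b bs

biword : State → List Ball
biword [] = []
biword (b ∷ s) = insertSorted b (biword s)

-- tableaux as lists of rows (top row first)
Tableau : Set → Set
Tableau A = List (List A)

insertRow : ℕ → List ℕ → List ℕ × Maybe ℕ
insertRow x [] = [ x ] , nothing
insertRow x (y ∷ ys) =
  if does (x ℕ.<? y) then (x ∷ ys , just y)
  else (let r = insertRow x ys in (y ∷ proj₁ r , proj₂ r))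

rowInsert : ℕ → Tableau ℕ → Tableau ℕ × ℕ
rowInsert x [] = [ [ x ] ] , 0
rowInsert x (r ∷ rs) with insertRow x r
... | r' , nothing = (r' ∷ rs) , 0
... | r' , just y  = let res = rowInsert y rs in (r' ∷ proj₁ res) , suc (proj₂ res)

addAt : {A : Set} → ℕ → A → Tableau A → Tableau A
addAt zero a [] = [ [ a ] ]
addAt zero a (r ∷ rs) = (r ++ [ a ]) ∷ rs
addAt (suc i) a [] = [ [ a ] ]
addAt (suc i) a (r ∷ rs) = r ∷ addAt i a rs

RSKstep : Tableau ℕ × Tableau ℤ → Ball → Tableau ℕ × Tableau ℤ
RSKstep (P , Q) (j , c) = let res = rowInsert c P in proj₁ res , addAt (proj₂ res) j Q

RSK : State → Tableau ℕ × Tableau ℤ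
RSK s = foldl RSKstep ([] , []) (biword s)

Psym : State → Tableau ℕ
Psym s = proj₁ (RSK s)

Qsym : State → Tableau ℤ
Qsym s = proj₂ (RSK s)

W : {A : Set} → Tableau A → List A
W T = concat (reverse T)

IsSlotBoundary : (δ : ℤ → ℕ) → (d : ℤ → ℤ) → Set
IsSlotBoundary δ d = ∀ j → d j - d (j - + 1) ≡ + δ j

rangeℤ : ℤ → ℕ → List ℤ
rangeℤ a k = map (λ i → a + + i) (upTo k)

-- slots of box j: (slot, label j, occupied?) for slots d(j-1)+1 … d j;
-- the m balls of the box occupy its rightmost m slots
boxSlots : (d : ℤ → ℤ) → (δ : ℤ → ℕ) → State → ℤ → List (ℤ × ℤ × Bool)
boxSlots d δ s j =
  map (λ i → i , j , does ((d j - + occ s j) ℤ.<? i))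
      (rangeℤ (d (j - + 1) + + 1) (δ j))

minBox : ℤ → State → ℤ
minBox a [] = a
minBox a ((j , _) ∷ s) = minBox (a ⊓ j) s

maxBox : ℤ → State → ℤ
maxBox a [] = a
maxBox a ((j , _) ∷ s) = maxBox (a ⊔ j) s

minList : ℤ → List ℤ → ℤ
minList a [] = a
minList a (x ∷ xs) = minList (a ⊓ x) xs

maxList : ℤ → List ℤ → ℤ
maxList a [] = a
maxList a (x ∷ xs) = maxList (a ⊔ x) xs

-- the initial carrier C: labels of empty slots i in [p, q], in slot order,
-- where p = smallest occupied slot and q = largest occupied slot + N.
-- Slots are enumerated over boxes jmin, …, jmax + N, which covers [p, q]
-- since every box has at least one slot.
initialCarrier : (d : ℤ → ℤ) → (δ : ℤ → ℕ) → State → List ℤ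
initialCarrier d δ [] = []
initialCarrier d δ s@((j₀ , _) ∷ _) =
  let N     = length s
      jmin  = minBox j₀ s
      jmax  = maxBox j₀ s
      boxes = rangeℤ jmin (suc (ℤ.∣ jmax - jmin ∣ ℕ.+ N))
      slots = concatMap (boxSlots d δ s) boxes
      occd  = map proj₁ (filter (λ t → proj₂ (proj₂ t) B.≟ true) slots)
      p     = minList (d jmin) occd
      q     = maxList (d jmin) occd + + N
      keep  = λ (t : ℤ × ℤ × Bool) →
                not (proj₂ (proj₂ t)) ∧ does (p ℤ.≤? proj₁ t) ∧ does (proj₁ t ℤ.≤? q)
  in map (λ t → proj₁ (proj₂ t)) (filter (λ t → keep t B.≟ true) slots)

minAbove : ℤ → List ℤ → Maybe ℤ
minAbove x [] = nothing
minAbove x (y ∷ ys) with minAbove x ys | does (x ℤ.<? y)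
... | r       | false = r
... | nothing | true  = just y
... | just z  | true  = just (y ⊓ z)

removeOneℤ : ℤ → List ℤ → List ℤ
removeOneℤ x [] = []
removeOneℤ x (y ∷ ys) = if does (x ℤ.≟ y) then ys else y ∷ removeOneℤ x ys

insertℤ : ℤ → List ℤ → List ℤ
insertℤ x [] = [ x ]
insertℤ x (y ∷ ys) = if does (x ℤ.≤? y) then x ∷ y ∷ ys else y ∷ insertℤ x ys

carrierStep : List ℤ → ℤ → ℤ × List ℤ
carrierStep C w with minAbove w C
... | just w' = w' , insertℤ w (removeOneℤ w' C)
... | nothing with C
...   | []     = w , []          -- never used: C is nonempty when w is
...   | c ∷ cs = let w' = minList c cs in w' , insertℤ w (removeOneℤ w' C)

carrierOutput : List ℤ → List ℤ → List ℤ
carrierOutput C [] = []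
carrierOutput C (w ∷ ws) = let r = carrierStep C w in proj₁ r ∷ carrierOutput (proj₂ r) ws

{-# OPTIONS --safe #-}

-- List the balls by increasing color, and by increasing box within a color.  This
-- is the order in which they are moved, and moving a ball from box j to box k is a
-- step of the carrier algorithm on the multiset of empty slots.  By the symmetry of
-- RSK, inserting the boxes in this order yields Q(s) as insertion tableau and P(s) as
-- recording tableau.  So it suffices that a carrier commutes with RSK insertion.  As
-- long as the minimum of the carrier is never resorted to, a carrier step is itself a
-- row insertion; it preserves descents, and it maps words related by an elementary
-- Knuth transformation to words related by one at the same place.  Row insertion is a
-- chain of such transformations steered by descents, hence the carrier maps W(Q(s)) to
-- the reading word of the insertion tableau of the output, with the same recording
-- tableau.
module Submission where

open import Defs
open import Data.Bool.Base using (Bool; true; false; not; _∧_)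
import Data.Bool.Properties as Boolₚ
open import Data.Nat as ℕ using (ℕ; zero; suc; _≥_; z≤n; s≤s)
import Data.Nat.Properties as ℕₚ
open import Data.Integer as ℤ using (ℤ; +_)
import Data.Integer.Properties as ℤₚ
import Algebra.Properties.AbelianGroup ℤₚ.+-0-abelianGroup as ℤ+ₚ
open import Data.Integer.Tactic.RingSolver using (solve-∀)
open import Data.Fin.Base using (Fin; toℕ)
import Data.Fin.Properties as Finₚ
open import Data.Product as × using (_×_; _,_; proj₁; proj₂; ∃-syntax)
import Data.Product.Properties as ×ₚ
open import Data.Sum using (_⊎_; inj₁; inj₂)
open import Data.Empty using (⊥-elim)
open import Data.Maybe.Base using (Maybe; just; nothing)
open import Data.List.Base using
  ( List; []; _∷_; _++_; [_]; _∷ʳ_; length; map; concat; concatMap; filter; foldr; foldl; reverse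
  ; replicate; applyUpTo; upTo; lookup )
import Data.List.Properties as Listₚ
open import Data.List.Relation.Unary.All as All using (All; []; _∷_)
import Data.List.Relation.Unary.All.Properties as Allₚ
open import Data.List.Relation.Unary.AllPairs using (AllPairs; []; _∷_)
import Data.List.Relation.Unary.AllPairs.Properties as AllPairsₚ
open import Data.List.Relation.Unary.Any as Any using (here; there)
import Data.List.Relation.Unary.Any.Properties as Anyₚ
open import Data.List.Membership.Propositional using (_∈_)
import Data.List.Membership.Propositional.Properties as ∈ₚ
open import Data.List.Relation.Binary.Permutation.Propositional
open import Data.List.Relation.Binary.Permutation.Propositional.Properties as ↭ₚ using ()
open import Function.Base using (_∘_; flip; id)
open import Relation.Nullary using (¬_; Dec; yes; no; ofʸ; ofⁿ)
open import Relation.Nullary.Decidable using (does; dec-true; dec-false; _⊎-dec_; _×-dec_)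
open import Relation.Binary.Definitions using (DecidableEquality)
open import Relation.Binary.PropositionalEquality as ≡ using (_≡_; _≢_; refl; sym; cong; cong₂; subst)

-- Parts (1) and (2) mention no slot boundaries, so the dynamics runs on a carrier of its own: the
-- labels of all empty slots in a window made of the boxes around the balls and, to their right, as
-- many further boxes as there are balls. Every ball starts at or left of the last box of the first
-- group, so a move uses up at most one empty slot beyond that box, and the supply never runs out.
-- This carrier depends only on the window and on how many balls each box holds, which Q(s)
-- determines; so two states with equal Q-symbols can share one carrier. The initial carrier of (3)
-- is a contiguous segment of such a window, and the labels cut off at its two ends are never
-- touched.
--
-- RSK is treated one row at a time: a pass through one row leaves a row of each tableau and, for
-- the next row, the biword of bumped letters. That the carrier can process the rearranged word
-- W(Q(s)) without its minimum is not assumed: runs are relations, and every rearrangement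
-- constructs the new run from the old one, with the same final carrier.

record LinearOrder (A : Set) : Set₁ where
  infix 4 _<_ _≤_
  field
    _<_ _≤_ : A → A → Set
    ≤-refl  : ∀ {x} → x ≤ x
    ≤-trans : ∀ {x y z} → x ≤ y → y ≤ z → x ≤ z
    <-≤-trans : ∀ {x y z} → x < y → y ≤ z → x < z
    ≤-<-trans : ∀ {x y z} → x ≤ y → y < z → x < z
    <⇒≤ : ∀ {x y} → x < y → x ≤ y
    ≤⇒≯ : ∀ {x y} → x ≤ y → ¬ (y < x)
    <-or-≥ : ∀ x y → x < y ⊎ y ≤ x
    ≤⇒<⊎≡ : ∀ {x y} → x ≤ y → x < y ⊎ x ≡ y
    _≟_ : DecidableEquality A

  <-trans : ∀ {x y z} → x < y → y < z → x < z
  <-trans p q = <-≤-trans p (<⇒≤ q)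

ℕ-order : LinearOrder ℕ
ℕ-order = record
  { _<_ = ℕ._<_ ; _≤_ = ℕ._≤_ ; ≤-refl = ℕₚ.≤-refl ; ≤-trans = ℕₚ.≤-trans
  ; <-≤-trans = ℕₚ.<-≤-trans ; ≤-<-trans = ℕₚ.≤-<-trans ; <⇒≤ = ℕₚ.<⇒≤ ; ≤⇒≯ = ℕₚ.≤⇒≯
  ; <-or-≥ = ℕₚ.<-≤-connex ; ≤⇒<⊎≡ = ℕₚ.m≤n⇒m<n∨m≡n ; _≟_ = ℕ._≟_ }

ℤ-order : LinearOrder ℤ
ℤ-order = record
  { _<_ = ℤ._<_ ; _≤_ = ℤ._≤_ ; ≤-refl = ℤₚ.≤-refl ; ≤-trans = ℤₚ.≤-trans
  ; <-≤-trans = ℤₚ.<-≤-trans ; ≤-<-trans = ℤₚ.≤-<-trans ; <⇒≤ = ℤₚ.<⇒≤ ; ≤⇒≯ = ℤₚ.≤⇒≯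
  ; <-or-≥ = <-or-≥ ; ≤⇒<⊎≡ = ≤⇒<⊎≡ ; _≟_ = ℤ._≟_ }
  where
  <-or-≥ : ∀ x y → x ℤ.< y ⊎ y ℤ.≤ x
  <-or-≥ x y with x ℤ.<? y
  ... | yes p = inj₁ p
  ... | no ¬p = inj₂ (ℤₚ.≮⇒≥ ¬p)
  ≤⇒<⊎≡ : ∀ {x y} → x ℤ.≤ y → x ℤ.< y ⊎ x ≡ y
  ≤⇒<⊎≡ {x} {y} p with x ℤ.≟ y
  ... | yes q = inj₂ q
  ... | no ¬q = inj₁ (ℤₚ.≤∧≢⇒< p ¬q)

-- Lexicographically sorted biwords

module Lex {K X : Set} (OK : LinearOrder K) (OX : LinearOrder X) where
  private module K = LinearOrder OK
  private module X = LinearOrder OX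

  infix 4 _⊑_
  _⊑_ : K × X → K × X → Set
  (k , x) ⊑ (k' , x') = k K.< k' ⊎ (k ≡ k' × x X.≤ x')

  ⊑-trans : ∀ {a b c} → a ⊑ b → b ⊑ c → a ⊑ c
  ⊑-trans (inj₁ p) (inj₁ q) = inj₁ (K.<-trans p q)
  ⊑-trans (inj₁ p) (inj₂ (refl , _)) = inj₁ p
  ⊑-trans (inj₂ (refl , _)) (inj₁ q) = inj₁ q
  ⊑-trans (inj₂ (refl , p)) (inj₂ (refl , q)) = inj₂ (refl , X.≤-trans p q)

  ⊑⇒≤ : ∀ {a b} → a ⊑ b → proj₁ a K.≤ proj₁ b
  ⊑⇒≤ (inj₁ p) = K.<⇒≤ p
  ⊑⇒≤ (inj₂ (refl , _)) = K.≤-refl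

  Descending : List (K × X) → Set
  Descending = AllPairs (flip _⊑_)

AllPairs-delete : ∀ {A : Set} {R : A → A → Set} xs {y ys} →
                  AllPairs R (xs ++ y ∷ ys) → AllPairs R (xs ++ ys)
AllPairs-delete [] (_ ∷ ps) = ps
AllPairs-delete (x ∷ xs) (px ∷ ps) =
  Allₚ.++⁺ (Allₚ.++⁻ˡ xs px) (All.tail (Allₚ.++⁻ʳ xs px)) ∷ AllPairs-delete xs ps

AllPairs-middle : ∀ {A : Set} {R : A → A → Set} xs {y ys} →
                  AllPairs R (xs ++ y ∷ ys) → All (flip R y) xs × All (R y) ys
AllPairs-middle [] (py ∷ _) = [] , py
AllPairs-middle (x ∷ xs) (px ∷ ps) =
  let l , r = AllPairs-middle xs ps in All.head (Allₚ.++⁻ʳ xs px) ∷ l , r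

AllPairs-++ˡ : ∀ {A : Set} {R : A → A → Set} xs {ys} → AllPairs R (xs ++ ys) → AllPairs R xs
AllPairs-++ˡ [] _ = []
AllPairs-++ˡ (_ ∷ xs) (px ∷ ps) = Allₚ.++⁻ˡ xs px ∷ AllPairs-++ˡ xs ps

AllPairs-++ʳ : ∀ {A : Set} {R : A → A → Set} xs {ys} → AllPairs R (xs ++ ys) → AllPairs R ys
AllPairs-++ʳ [] ps = ps
AllPairs-++ʳ (_ ∷ xs) (_ ∷ ps) = AllPairs-++ʳ xs ps

AllPairs-reverse : ∀ {A : Set} {R : A → A → Set} {xs} → AllPairs R xs → AllPairs (flip R) (reverse xs)
AllPairs-reverse [] = []
AllPairs-reverse {R = R} {x ∷ xs} (px ∷ ps) =
  subst (AllPairs (flip R)) (sym (Listₚ.unfold-reverse x xs))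
    (AllPairsₚ.++⁺ (AllPairs-reverse ps) ([] ∷ [])
      (All.map (_∷ []) (↭ₚ.All-resp-↭ (↭-sym (↭ₚ.↭-reverse xs)) px)))

∈-split-first : ∀ {A : Set} → DecidableEquality A → ∀ {x : A} {xs} → x ∈ xs →
                ∃[ ys ] ∃[ zs ] xs ≡ ys ++ x ∷ zs × All (x ≢_) ys
∈-split-first _≟_ {x} {y ∷ xs} x∈xs with x ≟ y
... | yes refl = [] , xs , refl , []
∈-split-first _≟_ (here x≡y) | no x≢y = ⊥-elim (x≢y x≡y)
∈-split-first _≟_ {x} {y ∷ xs} (there x∈xs) | no x≢y =
  let ys , zs , eq , x∉ys = ∈-split-first _≟_ x∈xs
  in y ∷ ys , zs , cong (y ∷_) eq , x≢y ∷ x∉ys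

-- Row insertion, and RSK one row at a time

module Insertion {X : Set} (O : LinearOrder X) where
  open LinearOrder O

  -- A relation that covers only the insertions that displace a letter. It thus serves equally for a
  -- row of a tableau and for a carrier that does not fall back on its minimum.
  data Bump : List X → X → List X → X → Set where
    here  : ∀ {x y r} → x < y → Bump (y ∷ r) x (x ∷ r) y
    there : ∀ {x y r r' z} → y ≤ x → Bump r x r' z → Bump (y ∷ r) x (y ∷ r') z

  bump-deterministic : ∀ {r x r₁ y₁ r₂ y₂} → Bump r x r₁ y₁ → Bump r x r₂ y₂ → r₁ ≡ r₂ × y₁ ≡ y₂
  bump-deterministic (here _) (here _) = refl , refl
  bump-deterministic (here p) (there q _) = ⊥-elim (≤⇒≯ q p)
  bump-deterministic (there q _) (here p) = ⊥-elim (≤⇒≯ q p)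
  bump-deterministic (there _ p) (there _ q) with refl , refl ← bump-deterministic p q = refl , refl

  bump-> : ∀ {r x r' y} → Bump r x r' y → x < y
  bump-> (here p) = p
  bump-> (there _ p) = bump-> p

  bump-↭ : ∀ {r x r' y} → Bump r x r' y → y ∷ r' ↭ x ∷ r
  bump-↭ (here _) = swap _ _ refl
  bump-↭ (there _ p) = trans (swap _ _ refl) (trans (prep _ (bump-↭ p)) (swap _ _ refl))

  bump-length : ∀ {r x r' y} → Bump r x r' y → length r' ≡ length r
  bump-length (here _) = refl
  bump-length (there _ p) = cong suc (bump-length p)

  bump-All : ∀ {P : X → Set} {r x r' y} → All P r → P x → Bump r x r' y → All P r'
  bump-All (py ∷ pr) px (here _) = px ∷ pr
  bump-All (py ∷ pr) px (there _ b) = py ∷ bump-All pr px b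

  bump-++ : ∀ {r x r' y} s → Bump r x r' y → Bump (r ++ s) x (r' ++ s) y
  bump-++ s (here p) = here p
  bump-++ s (there p b) = there p (bump-++ s b)

  ++-bump : ∀ {r x r' y} s → All (_≤ x) s → Bump r x r' y → Bump (s ++ r) x (s ++ r') y
  ++-bump [] [] b = b
  ++-bump (_ ∷ s) (p ∷ ps) b = there p (++-bump s ps b)

  bump-last : ∀ {r x z} → All (_≤ x) r → x < z → Bump (r ∷ʳ z) x (r ∷ʳ x) z
  bump-last {r} ps p = ++-bump r ps (here p)

  ¬bump : ∀ {r x r' y} → All (_≤ x) r → ¬ Bump r x r' y
  ¬bump (p ∷ _) (here q) = ≤⇒≯ p q
  ¬bump (_ ∷ ps) (there _ b) = ¬bump ps b

  bump? : ∀ r x → All (_≤ x) r ⊎ (∃[ r' ] ∃[ y ] Bump r x r' y)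
  bump? [] x = inj₁ []
  bump? (y ∷ r) x with <-or-≥ x y
  ... | inj₁ x<y = inj₂ (_ , _ , here x<y)
  ... | inj₂ y≤x with bump? r x
  ...   | inj₁ r≤x = inj₁ (y≤x ∷ r≤x)
  ...   | inj₂ (_ , _ , b) = inj₂ (_ , _ , there y≤x b)

  bump-out-All : ∀ {P : X → Set} {r x r' y} → All P r → Bump r x r' y → P y
  bump-out-All (py ∷ _) (here _) = py
  bump-out-All (_ ∷ pr) (there _ b) = bump-out-All pr b

  Ascending : List X → Set
  Ascending = AllPairs _≤_

  bump-ascending : ∀ {r x r' y} → Ascending r → Bump r x r' y → Ascending r'
  bump-ascending (py ∷ pr) (here x<y) = All.map (≤-trans (<⇒≤ x<y)) py ∷ pr
  bump-ascending (py ∷ pr) (there y≤x b) = bump-All py y≤x b ∷ bump-ascending pr b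

  -- `x₁` now stands where `y₁` stood. The second letter passes over it, and everything further
  -- right is at least `y₁`.
  bump-monotone : ∀ {r x₁ r₁ y₁ x₂ r₂ y₂} → Ascending r → Bump r x₁ r₁ y₁ → Bump r₁ x₂ r₂ y₂ →
                  x₁ ≤ x₂ → y₁ ≤ y₂
  bump-monotone _ (here _) (here q) x₁≤x₂ = ⊥-elim (≤⇒≯ x₁≤x₂ q)
  bump-monotone (py ∷ _) (here _) (there q b) _ = bump-out-All py b
  bump-monotone _ (there p _) (here q) x₁≤x₂ = ⊥-elim (≤⇒≯ (≤-trans p x₁≤x₂) q)
  bump-monotone (_ ∷ pr) (there _ b) (there _ b') x₁≤x₂ = bump-monotone pr b b' x₁≤x₂

  -- The second letter stops at the new `x₁` or before it, so what it displaces is at most `x₁`,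
  -- which is below `y₁`.
  bump-antitone : ∀ {r x₁ r₁ y₁ x₂ r₂ y₂} → Bump r x₁ r₁ y₁ → Bump r₁ x₂ r₂ y₂ →
                  x₂ < x₁ → y₂ < y₁
  bump-antitone (here p) (here _) _ = p
  bump-antitone (here _) (there p _) x₂<x₁ = ⊥-elim (≤⇒≯ p x₂<x₁)
  bump-antitone (there p b) (here _) _ = ≤-<-trans p (bump-> b)
  bump-antitone (there _ b) (there _ b') x₂<x₁ = bump-antitone b b' x₂<x₁

  module _ {K : Set} where

    -- Biwords are listed with the ball inserted last at the head.
    data Pass : List (K × X) → List X → List K → List (K × X) → Set where
      []     : Pass [] [] [] []
      append : ∀ {k x L r q o} → Pass L r q o → All (_≤ x) r →
               Pass ((k , x) ∷ L) (r ∷ʳ x) (q ∷ʳ k) o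
      bump   : ∀ {k x L r q o r' y} → Pass L r q o → Bump r x r' y →
               Pass ((k , x) ∷ L) r' q ((k , y) ∷ o)

    -- `row` demands a nonempty biword, so no empty rows are produced and the lists of rows are
    -- exactly the tableaux of RSK.
    data Rows : List (K × X) → List (List X) → List (List K) → Set where
      []  : Rows [] [] []
      row : ∀ {b L r q o P Q} → Pass (b ∷ L) r q o → Rows o P Q → Rows (b ∷ L) (r ∷ P) (q ∷ Q)

    pass-total : ∀ L → ∃[ r ] ∃[ q ] ∃[ o ] Pass L r q o
    pass-total [] = _ , _ , _ , []
    pass-total ((k , x) ∷ L) with r , q , o , p ← pass-total L | bump? r x
    ... | inj₁ r≤x = _ , _ , _ , append p r≤x
    ... | inj₂ (_ , _ , b) = _ , _ , _ , bump p b

    pass-shorter : ∀ {b L r q o} → Pass (b ∷ L) r q o → length o ℕ.≤ length L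
    pass-shorter {L = []} (append [] _) = z≤n
    pass-shorter {L = []} (bump [] ())
    pass-shorter {L = _ ∷ _} (append p _) = ℕₚ.m≤n⇒m≤1+n (pass-shorter p)
    pass-shorter {L = _ ∷ _} (bump p _) = s≤s (pass-shorter p)

    rows-total : ∀ L → ∃[ P ] ∃[ Q ] Rows L P Q
    rows-total L = go (length L) L ℕₚ.≤-refl
      where
      go : ∀ n L → length L ℕ.≤ n → ∃[ P ] ∃[ Q ] Rows L P Q
      go n [] _ = _ , _ , []
      go (suc n) (b ∷ L) (s≤s l) =
        let _ , _ , o , p = pass-total (b ∷ L)
            _ , _ , R = go n o (ℕₚ.≤-trans (pass-shorter p) l)
        in _ , _ , row p R

    pass-length : ∀ {L r q o} → Pass L r q o → length r ≡ length q
    pass-length [] = refl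
    pass-length (append {k} {x} {r = r} {q} p _) = begin
      length (r ∷ʳ x) ≡⟨ Listₚ.length-++ r ⟩
      length r ℕ.+ 1  ≡⟨ cong (ℕ._+ 1) (pass-length p) ⟩
      length q ℕ.+ 1  ≡⟨ Listₚ.length-++ q ⟨
      length (q ∷ʳ k) ∎
      where open ≡.≡-Reasoning
    pass-length (bump p b) = ≡.trans (bump-length b) (pass-length p)

    rows-shape : ∀ {L P Q} → Rows L P Q → map length P ≡ map length Q
    rows-shape [] = refl
    rows-shape (row p R) = cong₂ _∷_ (pass-length p) (rows-shape R)

    pass-↭ : ∀ {L r q o} → Pass L r q o → r ++ map proj₂ o ↭ map proj₂ L
    pass-↭ [] = refl
    pass-↭ (append {x = x} {r = r} {o = o} p _) = begin
      (r ∷ʳ x) ++ map proj₂ o    ≡⟨ Listₚ.++-assoc r _ _ ⟩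
      r ++ x ∷ map proj₂ o       ↭⟨ ↭ₚ.shift x r _ ⟩
      x ∷ r ++ map proj₂ o       ↭⟨ prep x (pass-↭ p) ⟩
      x ∷ map proj₂ _            ∎
      where open PermutationReasoning
    pass-↭ (bump {x = x} {r = r} {o = o} {r' = r'} {y = y} p b) = begin
      r' ++ y ∷ map proj₂ o      ↭⟨ ↭ₚ.shift y r' _ ⟩
      y ∷ r' ++ map proj₂ o      ↭⟨ ↭ₚ.++⁺ʳ _ (bump-↭ b) ⟩
      x ∷ r ++ map proj₂ o       ↭⟨ prep x (pass-↭ p) ⟩
      x ∷ map proj₂ _            ∎
      where open PermutationReasoning

    rows-↭ : ∀ {L P Q} → Rows L P Q → concat P ↭ map proj₂ L
    rows-↭ [] = refl
    rows-↭ (row {r = r} p R) = trans (↭ₚ.++⁺ˡ r (rows-↭ R)) (pass-↭ p)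

    pass-All-letters : ∀ {P : X → Set} {L r q o} → Pass L r q o → All (P ∘ proj₂) L → All P r
    pass-All-letters [] [] = []
    pass-All-letters (append p _) (px ∷ ps) = Allₚ.∷ʳ⁺ (pass-All-letters p ps) px
    pass-All-letters (bump p b) (px ∷ ps) = bump-All (pass-All-letters p ps) px b

    pass-All-keys : ∀ {P : K → Set} {L r q o} → Pass L r q o → All (P ∘ proj₁) L →
                    All P q × All (P ∘ proj₁) o
    pass-All-keys [] [] = [] , []
    pass-All-keys (append p _) (pk ∷ ps) =
      let pq , po = pass-All-keys p ps in Allₚ.∷ʳ⁺ pq pk , po
    pass-All-keys (bump p _) (pk ∷ ps) =
      let pq , po = pass-All-keys p ps in pq , pk ∷ po

    pass-ascending : ∀ {L r q o} → Pass L r q o → Ascending r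
    pass-ascending [] = []
    pass-ascending (append p r≤x) =
      AllPairsₚ.++⁺ (pass-ascending p) ([] ∷ []) (All.map (_∷ []) r≤x)
    pass-ascending (bump p b) = bump-ascending (pass-ascending p) b

    pass-deterministic : ∀ {L} {r₁ q₁ o₁ r₂ q₂ o₂} → Pass L r₁ q₁ o₁ → Pass L r₂ q₂ o₂ →
                         r₁ ≡ r₂ × q₁ ≡ q₂ × o₁ ≡ o₂
    pass-deterministic [] [] = refl , refl , refl
    pass-deterministic (append p _) (append p' _) with refl , refl , refl ← pass-deterministic p p' = refl , refl , refl
    pass-deterministic (append p r≤x) (bump p' β) with refl , _ ← pass-deterministic p p' = ⊥-elim (¬bump r≤x β)
    pass-deterministic (bump p β) (append p' r≤x) with refl , _ ← pass-deterministic p p' = ⊥-elim (¬bump r≤x β)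
    pass-deterministic (bump p β) (bump p' β')
      with refl , refl , refl ← pass-deterministic p p'
      with refl , refl ← bump-deterministic β β' = refl , refl , refl

    rows-deterministic : ∀ {L} {P₁ Q₁ P₂ Q₂} → Rows L P₁ Q₁ → Rows L P₂ Q₂ → P₁ ≡ P₂ × Q₁ ≡ Q₂
    rows-deterministic [] [] = refl , refl
    rows-deterministic (row p R) (row p' R')
      with refl , refl , refl ← pass-deterministic p p'
      with refl , refl ← rows-deterministic R R' = refl , refl

    module _ (OK : LinearOrder K) where
      open Lex OK O

      -- The biword handed to the next row is sorted again. Bumps under one key displace weakly
      -- increasing letters. Once a letter has been appended, later letters with the same key are
      -- appended too, so the next bump has a strictly larger key.
      pass-next : ∀ {L r q o k x r' y} → Pass L r q o → Descending L → All (_⊑ (k , x)) L →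
                  Bump r x r' y → All (_⊑ (k , y)) o
      pass-next [] _ _ _ = []
      pass-next (append p r≤x) (dx ∷ _) (inj₁ k<k' ∷ _) b =
        All.map (λ k≤ → inj₁ (LinearOrder.≤-<-trans OK k≤ k<k'))
                (proj₂ (pass-All-keys p (All.map ⊑⇒≤ dx)))
      pass-next (append p r≤x) _ (inj₂ (_ , x≤x') ∷ _) b =
        ⊥-elim (¬bump (Allₚ.∷ʳ⁺ (All.map (λ z≤x → ≤-trans z≤x x≤x') r≤x) x≤x') b)
      pass-next (bump p b₀) (dx ∷ d) (lt ∷ _) b =
        step lt ∷ All.map (λ le → ⊑-trans le (step lt)) (pass-next p d dx b₀)
        where
        step : ∀ {k₀ k} → (k₀ , _) ⊑ (k , _) → (k₀ , _) ⊑ (k , _)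
        step (inj₁ k₀<k) = inj₁ k₀<k
        step (inj₂ (eq , x₀≤x)) = inj₂ (eq , bump-monotone (pass-ascending p) b₀ b x₀≤x)

      pass-descending : ∀ {L r q o} → Pass L r q o → Descending L → Descending o
      pass-descending [] _ = []
      pass-descending (append p _) (_ ∷ d) = pass-descending p d
      pass-descending (bump p b) (dx ∷ d) = pass-next p d dx b ∷ pass-descending p d

-- The symmetry of RSK

module Symmetry {A B : Set} (OA : LinearOrder A) (OB : LinearOrder B) where
  private
    module A = LinearOrder OA
    module B = LinearOrder OB
    module LA = Lex OB OA
    module LB = Lex OA OB
    module IA = Insertion OA
    module IB = Insertion OB
  -- A ball (b , a) with maximal b joins the first row.  It stays there unless
  -- some later ball is appended to that row: the first such ball bumps it.
  pass-insert-max : ∀ {a b L₂ r q o} L₁ →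
    All (λ e → (a A.< proj₁ e) × (proj₂ e B.< b)) L₁ →
    All (λ e → (proj₁ e A.≤ a) × (proj₂ e B.≤ b)) L₂ →
    IB.Pass (L₁ ++ L₂) r q o →
    (All (A._≤ a) q × IB.Pass (L₁ ++ (a , b) ∷ L₂) (r ∷ʳ b) (q ∷ʳ a) o)
    ⊎ (∃[ q' ] ∃[ e ] ∃[ o' ] IA.Bump q a q' e × IB.Pass (L₁ ++ (a , b) ∷ L₂) r q' o'
                              × o' ↭ (e , b) ∷ o)
  pass-insert-max [] [] small p =
    inj₁ ( proj₁ (IB.pass-All-keys p (All.map proj₁ small))
         , IB.append p (IB.pass-All-letters p (All.map proj₂ small)))
  pass-insert-max (_ ∷ L₁) ((a<e , b'<b) ∷ large) small (IB.append p r≤b')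
    with pass-insert-max L₁ large small p
  ... | inj₁ (q≤a , p') =
    inj₂ (_ , _ , _ , IA.bump-last q≤a a<e , IB.bump p' (IB.bump-last r≤b' b'<b) , refl)
  ... | inj₂ (_ , _ , _ , β , p' , o'↭) =
    inj₂ (_ , _ , _ , IA.bump-++ _ β , IB.append p' r≤b' , o'↭)
  pass-insert-max (_ ∷ L₁) ((a<e , b'<b) ∷ large) small (IB.bump p β)
    with pass-insert-max L₁ large small p
  ... | inj₁ (q≤a , p') = inj₁ (q≤a , IB.bump p' (IB.bump-++ _ β))
  ... | inj₂ (_ , _ , _ , β' , p' , o'↭) =
    inj₂ (_ , _ , _ , β' , IB.bump p' β , trans (prep _ o'↭) (swap _ _ refl))

  -- Induction on the ball inserted last into `L`. Its key `b` is maximal, so in `L'` it is a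
  -- maximal letter inserted somewhere in the middle, and `pass-insert-max` shows that its effect on
  -- the row of keys is that of inserting `a`. The bumped biwords need only agree up to permutation,
  -- because each side is sorted in its own order.
  pass-symmetric : ∀ {L L' r q o} → IA.Pass L r q o → LA.Descending L → LB.Descending L' →
    L' ↭ map ×.swap L → ∃[ o' ] IB.Pass L' q r o' × o' ↭ map ×.swap o
  pass-symmetric IA.[] _ _ L'↭ with refl ← ↭ₚ.↭-empty-inv L'↭ = _ , IB.[] , refl
  pass-symmetric {L = (b , a) ∷ L} p (max ∷ d) d' L'↭
    with L₁ , L₂ , refl , fresh ← ∈-split-first (×ₚ.≡-dec A._≟_ B._≟_)
                                    (↭ₚ.∈-resp-↭ (↭-sym L'↭) (here refl))
    = conclude p
    where
    rest↭ : L₁ ++ L₂ ↭ map ×.swap L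
    rest↭ = ↭ₚ.drop-mid L₁ [] L'↭

    bounds : All (λ e → ×.swap e LA.⊑ (b , a)) (L₁ ++ L₂)
    bounds = ↭ₚ.All-resp-↭ (↭-sym rest↭) (Allₚ.map⁺ max)

    -- Among equal balls the split picks the copy inserted last, so the balls inserted after it
    -- differ from it. Being later in the order of `L'` and earlier in that of `L`, they are
    -- strictly larger in `A` and strictly smaller in `B`.
    large : All (λ e → (a A.< proj₁ e) × (proj₂ e B.< b)) L₁
    large = All.map strict (All.zip (fresh , All.zip (proj₁ (AllPairs-middle L₁ d') , Allₚ.++⁻ˡ L₁ bounds)))
      where
      strict : ∀ {e} → (a , b) ≢ e × (a , b) LB.⊑ e × ×.swap e LA.⊑ (b , a) →
               (a A.< proj₁ e) × (proj₂ e B.< b)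
      strict (_ , inj₁ a<e , inj₁ e<b) = a<e , e<b
      strict (_ , inj₁ a<e , inj₂ (_ , e≤a)) = ⊥-elim (A.≤⇒≯ e≤a a<e)
      strict (_ , inj₂ (_ , b≤e) , inj₁ e<b) = ⊥-elim (B.≤⇒≯ b≤e e<b)
      strict (≢e , inj₂ (refl , _) , inj₂ (refl , _)) = ⊥-elim (≢e refl)

    small : All (λ e → (proj₁ e A.≤ a) × (proj₂ e B.≤ b)) L₂
    small = All.zipWith (λ (p , q) → LB.⊑⇒≤ p , LA.⊑⇒≤ q)
              (proj₂ (AllPairs-middle L₁ d') , Allₚ.++⁻ʳ L₁ bounds)

    conclude : ∀ {r q o} → IA.Pass ((b , a) ∷ L) r q o →
               ∃[ o' ] IB.Pass (L₁ ++ (a , b) ∷ L₂) q r o' × o' ↭ map ×.swap o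
    conclude (IA.append p r≤a)
      with _ , p₀ , o₀↭ ← pass-symmetric p d (AllPairs-delete L₁ d') rest↭
      with pass-insert-max L₁ large small p₀
    ... | inj₁ (_ , p') = _ , p' , o₀↭
    ... | inj₂ (_ , _ , _ , β , _) = ⊥-elim (IA.¬bump r≤a β)
    conclude (IA.bump p β)
      with _ , p₀ , o₀↭ ← pass-symmetric p d (AllPairs-delete L₁ d') rest↭
      with pass-insert-max L₁ large small p₀
    ... | inj₁ (r≤a , _) = ⊥-elim (IA.¬bump r≤a β)
    ... | inj₂ (_ , _ , _ , β' , p' , o'↭) with refl , refl ← IA.bump-deterministic β β' =
      _ , p' , trans o'↭ (prep _ o₀↭)

  rows-symmetric : ∀ {L L' P Q} → IA.Rows L P Q → LA.Descending L → LB.Descending L' →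
    L' ↭ map ×.swap L → IB.Rows L' Q P
  rows-symmetric IA.[] _ _ L'↭ with refl ← ↭ₚ.↭-empty-inv L'↭ = IB.[]
  rows-symmetric {L' = []} (IA.row _ _) _ _ L'↭ = ⊥-elim (↭ₚ.¬x∷xs↭[] (↭-sym L'↭))
  rows-symmetric {L' = _ ∷ _} (IA.row p R) d d' L'↭ =
    let _ , p' , o'↭ = pass-symmetric p d d' L'↭
    in IB.row p' (rows-symmetric R (IA.pass-descending OB p d) (IB.pass-descending OA p' d') o'↭)

-- The carrier algorithm

W-∷ : ∀ {A : Set} (r : List A) P → W (r ∷ P) ≡ W P ++ r
W-∷ r P = begin
  concat (reverse (r ∷ P))             ≡⟨ cong concat (Listₚ.unfold-reverse r P) ⟩
  concat (reverse P ++ [ r ])          ≡⟨ Listₚ.concat-++ (reverse P) [ r ] ⟨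
  concat (reverse P) ++ concat [ r ]   ≡⟨ cong (concat (reverse P) ++_) (Listₚ.++-identityʳ r) ⟩
  concat (reverse P) ++ r              ∎
  where open ≡.≡-Reasoning

++-injective : ∀ {A : Set} (ws xs : List A) {ys zs} → length ws ≡ length xs → ws ++ ys ≡ xs ++ zs → ws ≡ xs × ys ≡ zs
++-injective [] [] _ eq = refl , eq
++-injective (w ∷ ws) (x ∷ xs) len eq =
  let w≡x , eq' = Listₚ.∷-injective eq
      ws≡xs , ys≡zs = ++-injective ws xs (ℕₚ.suc-injective len) eq'
  in cong₂ _∷_ w≡x ws≡xs , ys≡zs

-- The shape tells where the rows end in the reading word. This is how a tableau is recovered from
-- the output of the carrier.
W-injective : ∀ {A : Set} (P P' : Tableau A) → map length P ≡ map length P' → W P ≡ W P' → P ≡ P'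
W-injective [] [] _ _ = refl
W-injective (r ∷ P) (r' ∷ P') shape eq =
  let _ , shape' = Listₚ.∷-injective shape
      WP≡ , r≡r' = ++-injective (W P) (W P') (W-length P P' shape')
                     (≡.trans (sym (W-∷ r P)) (≡.trans eq (W-∷ r' P')))
  in cong₂ _∷_ r≡r' (W-injective P P' shape' WP≡)
  where
  W-length : ∀ P P' → map length P ≡ map length P' → length (W P) ≡ length (W P')
  W-length [] [] _ = refl
  W-length (r ∷ P) (r' ∷ P') shape = begin
    length (W (r ∷ P))               ≡⟨ ≡.trans (cong length (W-∷ r P)) (Listₚ.length-++ (W P)) ⟩
    length (W P) ℕ.+ length r        ≡⟨ cong₂ ℕ._+_ (W-length P P' (proj₂ (Listₚ.∷-injective shape))) (proj₁ (Listₚ.∷-injective shape)) ⟩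
    length (W P') ℕ.+ length r'      ≡⟨ ≡.trans (cong length (W-∷ r' P')) (Listₚ.length-++ (W P')) ⟨
    length (W (r' ∷ P'))             ∎
    where open ≡.≡-Reasoning

module Carrier {X : Set} (O : LinearOrder X) where
  open LinearOrder O
  open Insertion O

  -- The carrier algorithm when the minimum of the carrier is never resorted to.
  data Run : List X → List X → List X → List X → Set where
    []  : ∀ {C} → Run C [] [] C
    _∷_ : ∀ {C x C₁ x' w w' C₂} → Bump C x C₁ x' → Run C₁ w w' C₂ → Run C (x ∷ w) (x' ∷ w') C₂

  run-++ : ∀ {C v v' C₁ w w' C₂} → Run C v v' C₁ → Run C₁ w w' C₂ → Run C (v ++ w) (v' ++ w') C₂
  run-++ [] ρ = ρ
  run-++ (β ∷ ρ₁) ρ₂ = β ∷ run-++ ρ₁ ρ₂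

  run-deterministic : ∀ {C w w₁ C₁ w₂ C₂} → Run C w w₁ C₁ → Run C w w₂ C₂ → w₁ ≡ w₂
  run-deterministic [] [] = refl
  run-deterministic (β₁ ∷ ρ₁) (β₂ ∷ ρ₂) with refl , refl ← bump-deterministic β₁ β₂ =
    cong (_ ∷_) (run-deterministic ρ₁ ρ₂)

  run-ascending : ∀ {C w w' C'} → Ascending C → Ascending w → Run C w w' C' → Ascending w'
  run-ascending _ _ [] = []
  run-ascending aC (x≤w ∷ aw) (β ∷ ρ) =
    head aC x≤w aw β ρ ∷ run-ascending (bump-ascending aC β) aw ρ
    where
    head : ∀ {C x C₁ x' w w' C₂} → Ascending C → All (x ≤_) w → Ascending w →
           Bump C x C₁ x' → Run C₁ w w' C₂ → All (x' ≤_) w'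
    head _ _ _ _ [] = []
    head aC (x≤z ∷ _) (z≤w ∷ aw) β (β' ∷ ρ) =
      x'≤z' ∷ All.map (≤-trans x'≤z') (head (bump-ascending aC β) z≤w aw β' ρ)
      where x'≤z' = bump-monotone aC β β' x≤z

  -- The elementary Knuth transformations of a word p q r with p ≤ q > r.
  data Knuth : (p q r p' q' r' : X) → Set where
    swap-last  : ∀ {p q r} → r < p → p ≤ q → Knuth p q r p r q
    swap-first : ∀ {p q r} → p ≤ r → r < q → Knuth p q r q p r

  -- Passing through a carrier respects Knuth transformations, but may exchange the two kinds.
  carrier-knuth : ∀ {C p q r p' q' r' D₁ D₂ D₃ x y z} → Ascending C → Knuth p q r p' q' r' →
    Bump C p D₁ x → Bump D₁ q D₂ y → Bump D₂ r D₃ z →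
    ∃[ x' ] ∃[ y' ] ∃[ z' ] Run C (p' ∷ q' ∷ r' ∷ []) (x' ∷ y' ∷ z' ∷ []) D₃ × Knuth x y z x' y' z'
  carrier-knuth _ (swap-last _ p≤q) (here _) (here q<p) _ = ⊥-elim (≤⇒≯ p≤q q<p)
  carrier-knuth (c≤ ∷ _) (swap-last r<p p≤q) (here p<c) (there _ β) (here _) =
    _ , _ , _ , here p<c ∷ here r<p ∷ there (<⇒≤ (<-≤-trans r<p p≤q)) β ∷ [] ,
    swap-last p<c (bump-out-All c≤ β)
  carrier-knuth _ (swap-last r<p _) (here _) (there _ _) (there p≤r _) = ⊥-elim (≤⇒≯ p≤r r<p)
  carrier-knuth _ (swap-last _ p≤q) (there c≤p _) (here q<c) _ = ⊥-elim (≤⇒≯ (≤-trans c≤p p≤q) q<c)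
  carrier-knuth (_ ∷ aC) (swap-last r<p p≤q) (there c≤p β₁) (there _ β₂) (here r<c) =
    _ , _ , _ , there c≤p β₁ ∷ here r<c ∷ there (<⇒≤ (<-≤-trans r<p p≤q)) β₂ ∷ [] ,
    swap-last (≤-<-trans c≤p (bump-> β₁)) (bump-monotone aC β₁ β₂ p≤q)
  carrier-knuth (_ ∷ aC) κ@(swap-last _ _) (there c≤p β₁) (there c≤q β₂) (there c≤r β₃)
    with _ , _ , _ , (β₁' ∷ β₂' ∷ β₃' ∷ []) , κ' ← carrier-knuth aC κ β₁ β₂ β₃ =
    _ , _ , _ , there c≤p β₁' ∷ there c≤r β₂' ∷ there c≤q β₃' ∷ [] , κ'
  carrier-knuth _ (swap-first p≤r r<q) (here _) (here q<p) _ = ⊥-elim (≤⇒≯ (≤-trans p≤r (<⇒≤ r<q)) q<p)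
  carrier-knuth _ (swap-first p≤r _) (here _) (there _ _) (here r<p) = ⊥-elim (≤⇒≯ p≤r r<p)
  carrier-knuth {c ∷ C} {q = q} (c≤ ∷ aC) (swap-first p≤r r<q) (here p<c) (there p≤q β₂) (there _ β₃)
    with <-or-≥ q c
  ... | inj₂ c≤q =
    _ , _ , _ , there c≤q β₂ ∷ here p<c ∷ there p≤r β₃ ∷ [] ,
    swap-first (bump-out-All (bump-All c≤ c≤q β₂) β₃) (bump-antitone β₂ β₃ r<q)
  -- Here the two kinds are exchanged. All entries behind `c` exceed `q`, so `p q r` comes out as
  -- `c d q`, with `d` the entry next to `c`, and `q p r` comes out as `c q d`. As `q < c ≤ d`, the
  -- outputs are related by `swap-last`.
  ... | inj₁ q<c = separate c≤ β₂ β₃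
    where
    separate : ∀ {C D₂ D₃ y z} → All (c ≤_) C → Bump C q D₂ y → Bump D₂ _ D₃ z →
      ∃[ x' ] ∃[ y' ] ∃[ z' ] Run (c ∷ C) (_ ∷ _ ∷ _ ∷ []) (x' ∷ y' ∷ z' ∷ []) (_ ∷ D₃) × Knuth c y z x' y' z'
    separate (c≤d ∷ _) (here q<d) (here _) =
      _ , _ , _ , here q<c ∷ here (≤-<-trans p≤r r<q) ∷ there p≤r (here (<-trans r<q q<d)) ∷ [] ,
      swap-last q<c c≤d
    separate _ (here _) (there q≤r _) = ⊥-elim (≤⇒≯ q≤r r<q)
    separate (c≤d ∷ _) (there d≤q _) _ = ⊥-elim (≤⇒≯ (≤-trans c≤d d≤q) q<c)
  carrier-knuth _ (swap-first p≤r r<q) (there c≤p _) (here q<c) _ =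
    ⊥-elim (≤⇒≯ (≤-trans c≤p (≤-trans p≤r (<⇒≤ r<q))) q<c)
  carrier-knuth _ (swap-first p≤r _) (there c≤p _) (there _ _) (here r<c) = ⊥-elim (≤⇒≯ (≤-trans c≤p p≤r) r<c)
  carrier-knuth (_ ∷ aC) κ@(swap-first _ _) (there c≤p β₁) (there c≤q β₂) (there c≤r β₃)
    with _ , _ , _ , (β₁' ∷ β₂' ∷ β₃' ∷ []) , κ' ← carrier-knuth aC κ β₁ β₂ β₃ =
    _ , _ , _ , there c≤q β₁' ∷ there c≤p β₂' ∷ there c≤r β₃' ∷ [] , κ'

  -- Bumping x into a row r turns the word r x into y r' by a chain of Knuth
  -- transformations that starts at the right end.
  bump-knuth : ∀ {a b r x r' y} → a ≤ b → Bump (a ∷ b ∷ r) x r' y →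
    ∃[ f ] ∃[ s ] ∃[ z ] ∃[ g ] ∃[ h ]
      Bump (b ∷ r) x (f ∷ s) z × Knuth a z f y g h × r' ≡ g ∷ h ∷ s
  bump-knuth a≤b (here x<a) =
    _ , _ , _ , _ , _ , here (<-≤-trans x<a a≤b) , swap-last x<a a≤b , refl
  bump-knuth a≤b (there a≤x (here x<b)) =
    _ , _ , _ , _ , _ , here x<b , swap-first a≤x x<b , refl
  bump-knuth a≤b (there a≤x β@(there b≤x β')) =
    _ , _ , _ , _ , _ , β , swap-first a≤b (≤-<-trans b≤x (bump-> β')) , refl

  -- Converse of `bump-knuth`, for either kind of transformation: the carrier may have changed the
  -- kind, yet the result must still be read as a bump into the longer row.
  knuth-bump : ∀ {a b r x f s z y g h} → a ≤ b →
    Bump (b ∷ r) x (f ∷ s) z → Knuth a z f y g h → Bump (a ∷ b ∷ r) x (g ∷ h ∷ s) y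
  knuth-bump a≤b (here x<b) (swap-last x<a _) = here x<a
  knuth-bump a≤b (here x<b) (swap-first a≤x _) = there a≤x (here x<b)
  knuth-bump a≤b (there _ _) (swap-last b<a _) = ⊥-elim (≤⇒≯ a≤b b<a)
  knuth-bump a≤b (there b≤x β) (swap-first _ _) = there (≤-trans a≤b b≤x) (there b≤x β)

  -- Induction along the row from its left end. With `a` already in the carrier, the bump into the
  -- rest of the row is transported first. One Knuth transformation remains, on the three leftmost
  -- letters; `carrier-knuth` transports it and `knuth-bump` turns its image into a bump. The
  -- carrier after these three letters is unchanged, so the rest of the run is kept.
  carrier-bump : ∀ {C w w' C₁ x C₂ x' w₁ y} → Ascending C → Ascending w →
    Run C w w' C₁ → Bump C₁ x C₂ x' → Bump w x w₁ y →
    ∃[ w₁' ] ∃[ y' ] Bump w' x' w₁' y' × Run C (y ∷ w₁) (y' ∷ w₁') C₂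
  carrier-bump _ _ (β₁ ∷ []) β₂ (here x<a) = _ , _ , here (bump-antitone β₁ β₂ x<a) , β₁ ∷ β₂ ∷ []
  carrier-bump _ _ (_ ∷ []) _ (there _ ())
  carrier-bump aC ((a≤b ∷ _) ∷ aw) (β₁ ∷ ρ@(β₂ ∷ _)) β γ
    with _ , _ , _ , _ , _ , γ' , κ , refl ← bump-knuth a≤b γ
    with _ ∷ _ , _ , δ , (η₁ ∷ η₂ ∷ ρ') ← carrier-bump (bump-ascending aC β₁) aw ρ β γ'
    with _ , _ , _ , (ζ₁ ∷ ζ₂ ∷ ζ₃ ∷ []) , κ' ← carrier-knuth aC κ β₁ η₁ η₂
    = _ , _ , knuth-bump (bump-monotone aC β₁ β₂ a≤b) δ κ' , ζ₁ ∷ ζ₂ ∷ ζ₃ ∷ ρ'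

  module _ {K : Set} where

    data BiRun (C : List X) : List (K × X) → List (K × X) → List X → Set where
      []   : BiRun C [] [] C
      snoc : ∀ {k L L' C₁ x C₂ x'} → BiRun C L L' C₁ → Bump C₁ x C₂ x' →
             BiRun C ((k , x) ∷ L) ((k , x') ∷ L') C₂

    birun-ascending : ∀ {C L L' C'} → Ascending C → BiRun C L L' C' → Ascending C'
    birun-ascending aC [] = aC
    birun-ascending aC (snoc ρ β) = bump-ascending (birun-ascending aC ρ) β

    -- A pass rearranges the inserted word into the bumped letters followed by the row. An appended
    -- letter stays last, and stays appendable since ascending words have ascending images; a bump
    -- moves the displaced letter in front of the row, by `carrier-bump`. Letters are appended or
    -- bumped at the same moments on both sides, so the row of keys `q` is the same.
    pass-carrier : ∀ {C L L' C' r q o} → Ascending C → BiRun C L L' C' → Pass L r q o →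
      ∃[ r' ] ∃[ o' ] ∃[ C₁ ] Pass L' r' q o' × BiRun C o o' C₁ × Run C₁ r r' C'
    pass-carrier _ [] [] = _ , _ , _ , [] , [] , []
    pass-carrier aC (snoc {x' = x'} ρ β) (append {k = k} p r≤x)
      with r' , _ , C₁ , p' , ρo , ρr ← pass-carrier aC ρ p =
      _ , _ , _ , append p' r'≤x' , ρo , ρrx
      where
      ρrx = run-++ ρr (β ∷ [])
      r'≤x' : All (_≤ x') r'
      r'≤x' = proj₁ (AllPairs-middle r' (run-ascending (birun-ascending aC ρo)
                       (pass-ascending (append {k = k} p r≤x)) ρrx))
    pass-carrier aC (snoc ρ β) (bump p γ)
      with _ , _ , _ , p' , ρo , ρr ← pass-carrier aC ρ p
      with _ , _ , γ' , (η ∷ ρ') ← carrier-bump (birun-ascending aC ρo) (pass-ascending p) ρr β γ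
      = _ , _ , _ , bump p' γ' , snoc ρo η , ρ'

    -- Applying `pass-carrier` again to the bumped letters puts each lower row in front of the row
    -- above it, which is the reading order of `W`.
    rows-carrier : ∀ {C L L' C' P Q} → Ascending C → BiRun C L L' C' → Rows L P Q →
      ∃[ P' ] Rows L' P' Q × Run C (W P) (W P') C'
    rows-carrier _ [] [] = _ , [] , []
    rows-carrier aC ρ@(snoc _ _) (row {r = r} {P = P} p R)
      with r' , _ , _ , p' , ρo , ρr ← pass-carrier aC ρ p
      with P' , R' , ρP ← rows-carrier aC ρo R
      = _ , row p' R' , ≡.subst₂ (λ v v' → Run _ v v' _) (sym (W-∷ r P)) (sym (W-∷ r' P')) (run-++ ρP ρr)

-- RSK and the carrier algorithm in terms of rows and runs

module ℕI = Insertion ℕ-order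
module ℤI = Insertion ℤ-order
module BoxColor = Lex ℤ-order ℕ-order
module ColorBox = Lex ℕ-order ℤ-order
open Carrier ℤ-order
open ℤI using (Bump; Ascending; bump-↭; bump->; bump?)

insertRow-append : ∀ {x r} → All (ℕ._≤ x) r → insertRow x r ≡ (r ∷ʳ x , nothing)
insertRow-append [] = refl
insertRow-append {x} {y ∷ r} (y≤x ∷ r≤x)
  rewrite dec-false (x ℕ.<? y) (ℕₚ.≤⇒≯ y≤x) | insertRow-append r≤x = refl

insertRow-bump : ∀ {r x r' y} → ℕI.Bump r x r' y → insertRow x r ≡ (r' , just y)
insertRow-bump {y ∷ _} {x} (ℕI.here x<y) rewrite dec-true (x ℕ.<? y) x<y = refl
insertRow-bump {y ∷ _} {x} (ℕI.there y≤x β)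
  rewrite dec-false (x ℕ.<? y) (ℕₚ.≤⇒≯ y≤x) | insertRow-bump β = refl

rsk : List Ball → Tableau ℕ × Tableau ℤ
rsk = foldr (flip RSKstep) ([] , [])

RSKstep-append : ∀ {k x r q P Q} → All (ℕ._≤ x) r →
                 RSKstep (r ∷ P , q ∷ Q) (k , x) ≡ ((r ∷ʳ x) ∷ P , (q ∷ʳ k) ∷ Q)
RSKstep-append r≤x rewrite insertRow-append r≤x = refl

RSKstep-bump : ∀ {k x r q P Q r' y} → ℕI.Bump r x r' y →
               RSKstep (r ∷ P , q ∷ Q) (k , x) ≡
               (r' ∷ proj₁ (RSKstep (P , Q) (k , y)) , q ∷ proj₂ (RSKstep (P , Q) (k , y)))
RSKstep-bump β rewrite insertRow-bump β = refl

pass⇒rsk : ∀ {b L r q o} → ℕI.Pass (b ∷ L) r q o →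
           rsk (b ∷ L) ≡ (r ∷ proj₁ (rsk o) , q ∷ proj₂ (rsk o))
pass⇒rsk {L = []} (ℕI.append ℕI.[] _) = refl
pass⇒rsk {L = []} (ℕI.bump ℕI.[] ())
pass⇒rsk {L = _ ∷ _} (ℕI.append p r≤x) =
  ≡.trans (cong (λ t → RSKstep t _) (pass⇒rsk p)) (RSKstep-append r≤x)
pass⇒rsk {L = _ ∷ _} (ℕI.bump p β) =
  ≡.trans (cong (λ t → RSKstep t _) (pass⇒rsk p)) (RSKstep-bump β)

rows⇒rsk : ∀ {L P Q} → ℕI.Rows L P Q → rsk L ≡ (P , Q)
rows⇒rsk ℕI.[] = refl
rows⇒rsk (ℕI.row {r = r} {q = q} p R) =
  ≡.trans (pass⇒rsk p) (cong (λ (P , Q) → r ∷ P , q ∷ Q) (rows⇒rsk R))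

lexLeq? : ∀ b b' → Dec (b BoxColor.⊑ b')
lexLeq? (j , c) (j' , c') = (j ℤ.<? j') ⊎-dec ((j ℤ.≟ j') ×-dec (c ℕ.≤? c'))

⋢⇒⊒ : ∀ {b b'} → ¬ (b BoxColor.⊑ b') → b' BoxColor.⊑ b
⋢⇒⊒ {j , c} {j' , c'} ¬le with LinearOrder.<-or-≥ ℤ-order j j'
... | inj₁ j<j' = ⊥-elim (¬le (inj₁ j<j'))
... | inj₂ j'≤j with LinearOrder.≤⇒<⊎≡ ℤ-order j'≤j
...   | inj₁ j'<j = inj₁ j'<j
...   | inj₂ refl with ℕₚ.≤-total c c'
...     | inj₁ c≤c' = ⊥-elim (¬le (inj₂ (refl , c≤c')))
...     | inj₂ c'≤c = inj₂ (refl , c'≤c)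

insertSorted-↭ : ∀ b bs → insertSorted b bs ↭ b ∷ bs
insertSorted-↭ b [] = refl
insertSorted-↭ b (b' ∷ bs) with lexLeq b b'
... | true = refl
... | false = trans (prep b' (insertSorted-↭ b bs)) (swap b' b refl)

insertSorted-sorted : ∀ b {bs} → AllPairs BoxColor._⊑_ bs → AllPairs BoxColor._⊑_ (insertSorted b bs)
insertSorted-sorted b [] = [] ∷ []
insertSorted-sorted b {b' ∷ bs} (p ∷ ps) with lexLeq? b b'
... | yes le rewrite dec-true (lexLeq? b b') le = (le ∷ All.map (BoxColor.⊑-trans le) p) ∷ p ∷ ps
... | no ¬le rewrite dec-false (lexLeq? b b') ¬le =
  ↭ₚ.All-resp-↭ (↭-sym (insertSorted-↭ b bs)) (⋢⇒⊒ ¬le ∷ p) ∷ insertSorted-sorted b ps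

biword-↭ : ∀ s → biword s ↭ s
biword-↭ [] = refl
biword-↭ (b ∷ s) = trans (insertSorted-↭ b (biword s)) (prep b (biword-↭ s))

biword-sorted : ∀ s → AllPairs BoxColor._⊑_ (biword s)
biword-sorted [] = []
biword-sorted (b ∷ s) = insertSorted-sorted b (biword-sorted s)

-- With colors as keys and boxes as letters, the symmetry exchanges the two tableaux. Any sorted
-- listing of the balls is allowed, in particular the one recorded while the balls move.
RSK⇒rows : ∀ {s L} → L ↭ map ×.swap s → ColorBox.Descending L → ℤI.Rows L (Qsym s) (Psym s)
RSK⇒rows {s} L↭ d with P , Q , R ← ℕI.rows-total (reverse (biword s)) =
  subst (λ (P , Q) → ℤI.Rows _ Q P) (sym RSK≡)
    (Symmetry.rows-symmetric ℕ-order ℤ-order R (AllPairs-reverse (biword-sorted s)) d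
      (trans L↭ (↭ₚ.map⁺ ×.swap (↭-sym (trans (↭ₚ.↭-reverse (biword s)) (biword-↭ s))))))
  where
  RSK≡ : RSK s ≡ (P , Q)
  RSK≡ = ≡.trans (sym (Listₚ.reverse-foldr (flip RSKstep) ([] , []) (biword s))) (rows⇒rsk R)

minAbove-∈ : ∀ x C {y} → minAbove x C ≡ just y → y ∈ C
minAbove-∈ x (c ∷ C) eq with minAbove x C in eq' | does (x ℤ.<? c)
minAbove-∈ x (c ∷ C) eq   | just z  | false with refl ← eq = there (minAbove-∈ x C eq')
minAbove-∈ x (c ∷ C) refl | nothing | true = here refl
minAbove-∈ x (c ∷ C) refl | just z  | true with ℤₚ.⊓-sel c z
... | inj₁ c⊓z≡c = here c⊓z≡c
... | inj₂ c⊓z≡z = there (subst (_∈ C) (sym c⊓z≡z) (minAbove-∈ x C eq'))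

minAbove-bump : ∀ {C x C' y} → ℤI.Ascending C → ℤI.Bump C x C' y → minAbove x C ≡ just y
minAbove-bump {c ∷ C} {x} (c≤ ∷ _) (ℤI.here x<c)
  rewrite dec-true (x ℤ.<? c) x<c with minAbove x C in eq
... | nothing = refl
... | just z = cong just (ℤₚ.i≤j⇒i⊓j≡i (All.lookup c≤ (minAbove-∈ x C eq)))
minAbove-bump {c ∷ C} {x} (_ ∷ aC) (ℤI.there c≤x β)
  rewrite dec-false (x ℤ.<? c) (ℤₚ.≤⇒≯ c≤x) with minAbove x C | minAbove-bump aC β
... | just z | eq = eq

insertℤ-least : ∀ {x C} → All (x ℤ.≤_) C → insertℤ x C ≡ x ∷ C
insertℤ-least [] = refl
insertℤ-least {x} {y ∷ _} (x≤y ∷ _) rewrite dec-true (x ℤ.≤? y) x≤y = refl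

insertℤ-bump : ∀ {C x C' y} → ℤI.Ascending C → ℤI.Bump C x C' y → insertℤ x (removeOneℤ y C) ≡ C'
insertℤ-bump {c ∷ _} (c≤ ∷ _) (ℤI.here x<c)
  rewrite dec-true (c ℤ.≟ c) refl = insertℤ-least (All.map (ℤₚ.≤-trans (ℤₚ.<⇒≤ x<c)) c≤)
insertℤ-bump {c ∷ C} {x} {_} {y} (c≤ ∷ aC) (ℤI.there c≤x β)
  rewrite dec-false (y ℤ.≟ c) (λ y≡c → ℤₚ.≤⇒≯ c≤x (subst (x ℤ.<_) y≡c (ℤI.bump-> β)))
  with x ℤ.≤? c
... | no _ = cong (c ∷_) (insertℤ-bump aC β)
-- `insertℤ` puts `x` in front of equal entries, whereas `Bump` leaves `c` where it is; for `x = c`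
-- the resulting lists coincide.
... | yes x≤c with refl ← ℤₚ.≤-antisym x≤c c≤x =
  cong (c ∷_) (≡.trans (sym (insertℤ-least (removeOneℤ-All y C c≤))) (insertℤ-bump aC β))
  where
  removeOneℤ-All : ∀ {P : ℤ → Set} y C → All P C → All P (removeOneℤ y C)
  removeOneℤ-All y [] [] = []
  removeOneℤ-All y (c ∷ C) (p ∷ ps) with does (y ℤ.≟ c)
  ... | true = ps
  ... | false = p ∷ removeOneℤ-All y C ps

carrierStep-bump : ∀ {C x C' y} → ℤI.Ascending C → ℤI.Bump C x C' y → carrierStep C x ≡ (y , C')
carrierStep-bump {C} {x} aC β with minAbove x C | minAbove-bump aC β
... | just _ | refl = cong (_ ,_) (insertℤ-bump aC β)

carrierOutput-run : ∀ {C w w' C'} → ℤI.Ascending C → Run C w w' C' → carrierOutput C w ≡ w'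
carrierOutput-run _ [] = refl
carrierOutput-run aC (β ∷ ρ) rewrite carrierStep-bump aC β =
  cong (_ ∷_) (carrierOutput-run (ℤI.bump-ascending aC β) ρ)

-- The dynamics as a carrier run

count : ℤ → List ℤ → ℕ
count j xs = length (filter (ℤ._≟ j) xs)

occ≡count : ∀ s j → occ s j ≡ count j (map proj₁ s)
occ≡count [] j = refl
occ≡count ((i , _) ∷ s) j with does (i ℤ.≟ j)
... | true = cong suc (occ≡count s j)
... | false = occ≡count s j

count-↭ : ∀ j {xs ys} → xs ↭ ys → count j xs ≡ count j ys
count-↭ j p = ↭ₚ.↭-length (↭ₚ.filter-↭ (ℤ._≟ j) p)

count-++ : ∀ j xs ys → count j (xs ++ ys) ≡ count j xs ℕ.+ count j ys
count-++ j xs ys = ≡.trans (cong length (Listₚ.filter-++ (ℤ._≟ j) xs ys)) (Listₚ.length-++ (filter (ℤ._≟ j) xs))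

count-∷-≢ : ∀ {j i} xs → i ≢ j → count j (i ∷ xs) ≡ count j xs
count-∷-≢ {j} xs i≢j = cong length (Listₚ.filter-reject (ℤ._≟ j) i≢j)

count-All-≢ : ∀ {j xs} → All (_≢ j) xs → count j xs ≡ 0
count-All-≢ {j} ≢j = cong length (Listₚ.filter-none (ℤ._≟ j) ≢j)

∈⇒count>0 : ∀ {j xs} → j ∈ xs → 0 ℕ.< count j xs
∈⇒count>0 {j} j∈xs = Listₚ.filter-some (ℤ._≟ j) (Any.map sym j∈xs)

count>0⇒∈ : ∀ {j} xs → 0 ℕ.< count j xs → j ∈ xs
count>0⇒∈ {j} (x ∷ xs) pos with x ℤ.≟ j
... | yes refl = here refl
... | no _ = there (count>0⇒∈ xs pos)

≤⇒+ : ∀ {i j} → i ℤ.≤ j → ∃[ t ] j ≡ i ℤ.+ + t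
≤⇒+ {i} {j} i≤j = ℤ.∣ j ℤ.- i ∣ , (begin
  j                         ≡⟨ lemma j i ⟩
  i ℤ.+ (j ℤ.- i)           ≡⟨ cong (ℤ._+_ i) (ℤₚ.0≤i⇒+∣i∣≡i (ℤₚ.i≤j⇒0≤j-i i≤j)) ⟨
  i ℤ.+ + ℤ.∣ j ℤ.- i ∣     ∎)
  where
  open ≡.≡-Reasoning
  lemma : ∀ j i → j ≡ i ℤ.+ (j ℤ.- i)
  lemma = solve-∀

<⇒+1≤ : ∀ {i j} → i ℤ.< j → i ℤ.+ + 1 ℤ.≤ j
<⇒+1≤ {i} i<j = subst (ℤ._≤ _) (ℤₚ.+-comm (+ 1) i) (ℤₚ.i<j⇒suc[i]≤j i<j)

+1≤⇒< : ∀ {i j} → i ℤ.+ + 1 ℤ.≤ j → i ℤ.< j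
+1≤⇒< {i} le = ℤₚ.suc[i]≤j⇒i<j (subst (ℤ._≤ _) (ℤₚ.+-comm i (+ 1)) le)

-- Bounds the search of `nearest`: every full box that is passed over contains a ball, so the number
-- of such boxes is at most the number of balls, and the fuel suffices.
interval-pigeonhole : ∀ t k xs → (∀ i → i ℕ.< t → k ℤ.+ + i ∈ xs) → t ℕ.≤ length xs
interval-pigeonhole t k xs mem = Finₚ.injective⇒≤ {f = f} injective
  where
  f : Fin t → Fin (length xs)
  f i = Any.index (mem (toℕ i) (Finₚ.toℕ<n i))
  injective : ∀ {i j} → f i ≡ f j → i ≡ j
  injective {i} {j} eq = Finₚ.toℕ-injective (ℤₚ.+-injective (ℤ+ₚ.∙-cancelˡ k _ _ (begin
    k ℤ.+ + toℕ i    ≡⟨ Anyₚ.lookup-index (mem (toℕ i) (Finₚ.toℕ<n i)) ⟩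
    lookup xs (f i)  ≡⟨ cong (lookup xs) eq ⟩
    lookup xs (f j)  ≡⟨ Anyₚ.lookup-index (mem (toℕ j) (Finₚ.toℕ<n j)) ⟨
    k ℤ.+ + toℕ j    ∎)))
    where open ≡.≡-Reasoning

nearest-spec : ∀ δ S f t k → t ℕ.< f → (∀ i → i ℕ.< t → δ (k ℤ.+ + i) ℕ.≤ occ S (k ℤ.+ + i)) →
               occ S (k ℤ.+ + t) ℕ.< δ (k ℤ.+ + t) → nearest δ S f k ≡ k ℤ.+ + t
nearest-spec δ S (suc f) zero k _ _ free
  rewrite ℤₚ.+-identityʳ k | dec-true (occ S k ℕ.<? δ k) free = refl
nearest-spec δ S (suc f) (suc t) k (s≤s t<f) full free
  rewrite dec-false (occ S k ℕ.<? δ k)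
            (ℕₚ.≤⇒≯ (subst (λ j → δ j ℕ.≤ occ S j) (ℤₚ.+-identityʳ k) (full 0 (s≤s z≤n)))) =
  ≡.trans (nearest-spec δ S f t (k ℤ.+ + 1) t<f
            (λ i i<t → subst (λ j → δ j ℕ.≤ occ S j) (sym (shift i)) (full (suc i) (s≤s i<t)))
            (subst (λ j → occ S j ℕ.< δ j) (sym (shift t)) free))
          (shift t)
  where
  shift : ∀ i → k ℤ.+ + 1 ℤ.+ + i ≡ k ℤ.+ + suc i
  shift i = ℤₚ.+-assoc k (+ 1) (+ i)

data Leftmost (c : ℕ) (U : State) : Maybe ℤ → Set where
  none : All (λ b → proj₂ b ≢ c) U → Leftmost c U nothing
  some : ∀ {j} → (j , c) ∈ U → All (λ b → proj₂ b ≡ c → j ℤ.≤ proj₁ b) U → Leftmost c U (just j)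

minBoxOfColor-leftmost : ∀ c U → Leftmost c U (minBoxOfColor c U)
minBoxOfColor-leftmost c [] = none []
minBoxOfColor-leftmost c ((j , d) ∷ U)
  with minBoxOfColor c U | minBoxOfColor-leftmost c U | does (d ℕ.≟ c) | Dec.proof (d ℕ.≟ c)
... | nothing | none ≢c        | false | ofⁿ d≢c = none (d≢c ∷ ≢c)
... | just _  | some mem least | false | ofⁿ d≢c = some (there mem) ((⊥-elim ∘ d≢c) ∷ least)
... | nothing | none ≢c        | true | ofʸ refl =
  some (here refl) ((λ _ → ℤₚ.≤-refl) ∷ All.map (λ d≢c d≡c → ⊥-elim (d≢c d≡c)) ≢c)
... | just j' | some mem least | true | ofʸ refl =
  some mem' ((λ _ → ℤₚ.i⊓j≤i j j') ∷ All.map (λ le d≡c → ℤₚ.≤-trans (ℤₚ.i⊓j≤j j j') (le d≡c)) least)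
  where
  mem' : (j ℤ.⊓ j' , c) ∈ (j , c) ∷ U
  mem' with ℤₚ.⊓-sel j j'
  ... | inj₁ eq = here (cong (_, c) eq)
  ... | inj₂ eq = there (subst (λ i → (i , c) ∈ U) (sym eq) mem)

removeOne-↭ : ∀ {b U} → b ∈ U → U ↭ b ∷ removeOne b U
removeOne-↭ {j , c} {(j' , c') ∷ U} b∈ with (j ℤ.≟ j') ×-dec (c ℕ.≟ c')
... | yes (refl , refl)
  rewrite dec-true ((j ℤ.≟ j') ×-dec (c ℕ.≟ c')) (refl , refl) = refl
removeOne-↭ {j , c} {(j' , c') ∷ U} (here refl) | no b≢ = ⊥-elim (b≢ (refl , refl))
removeOne-↭ {j , c} {(j' , c') ∷ U} (there b∈) | no b≢
  rewrite dec-false ((j ℤ.≟ j') ×-dec (c ℕ.≟ c')) b≢ =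
  trans (prep _ (removeOne-↭ b∈)) (swap _ _ refl)

-- C can then carry m letters that are at most J without resorting to its minimum.
Enough : ℤ → ℕ → List ℤ → Set
Enough J m C = m ℕ.≤ length (filter (J ℤ.<?_) C)

-- Any entry beyond `J` exceeds `x`, so a bump exists. It adds no entry beyond `J` and removes at
-- most one.
enough⇒bump : ∀ {J m C x} → Enough J (suc m) C → x ℤ.≤ J →
              ∃[ C' ] ∃[ y ] Bump C x C' y × Enough J m C'
enough⇒bump {J} {m} {C} {x} en x≤J with bump? C x
... | inj₁ C≤x = ⊥-elim (ℕₚ.n≮0 (subst (suc m ℕ.≤_) (cong length
                   (Listₚ.filter-none (J ℤ.<?_) (All.map (λ z≤x → ℤₚ.≤⇒≯ (ℤₚ.≤-trans z≤x x≤J)) C≤x))) en))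
... | inj₂ (C' , y , β) = C' , y , β , ℕₚ.≤-pred (begin
  suc m                                         ≤⟨ en ⟩
  length (filter (J ℤ.<?_) C)                   ≡⟨ cong length (Listₚ.filter-reject (J ℤ.<?_) (ℤₚ.≤⇒≯ x≤J)) ⟨
  length (filter (J ℤ.<?_) (x ∷ C))             ≡⟨ ↭ₚ.↭-length (↭ₚ.filter-↭ (J ℤ.<?_) (bump-↭ β)) ⟨
  length (filter (J ℤ.<?_) (y ∷ C'))            ≤⟨ filter-∷ ⟩
  suc (length (filter (J ℤ.<?_) C'))            ∎)
  where
  open ℕₚ.≤-Reasoning
  filter-∷ : length (filter (J ℤ.<?_) (y ∷ C')) ℕ.≤ suc (length (filter (J ℤ.<?_) C'))
  filter-∷ with does (J ℤ.<? y)
  ... | true = ℕₚ.≤-refl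
  ... | false = ℕₚ.n≤1+n _

-- No entry lies strictly between `x` and `y`: for the empty slots, the boxes between the old and
-- the new box of a ball are full.
bump-least : ∀ {C x C' y} → Ascending C → Bump C x C' y → All (λ z → z ℤ.≤ x ⊎ y ℤ.≤ z) C
bump-least (c≤ ∷ _) (ℤI.here _) = inj₂ ℤₚ.≤-refl ∷ All.map inj₂ c≤
bump-least (_ ∷ aC) (ℤI.there c≤x β) = inj₁ c≤x ∷ bump-least aC β

bump-∈ : ∀ {C x C' y} → Bump C x C' y → y ∈ C
bump-∈ (ℤI.here _) = here refl
bump-∈ (ℤI.there _ β) = there (bump-∈ β)

-- moved lists the balls of s as (color , box), in the reverse of the order in which they move.
record Carries (C : List ℤ) (s s' : State) : Set where
  field
    {moved} : List (ℕ × ℤ)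
    {C'}    : List ℤ
    run     : BiRun C moved (map ×.swap s') C'
    perm    : moved ↭ map ×.swap s
    sorted  : ColorBox.Descending moved

module Evolution (n : ℕ) (δ : ℤ → ℕ) (δ≥1 : ∀ j → δ j ≥ 1) (lo hi : ℤ) where

  Balanced : List ℤ → List ℤ → Set
  Balanced E S = All (λ z → lo ℤ.≤ z × z ℤ.< hi) E
                 × (∀ x → lo ℤ.≤ x → x ℤ.< hi → count x (E ++ S) ≡ δ x)

  -- In a balanced window the entries of `E` are the empty slots, moved and unmoved balls both
  -- taking up room. The smallest label above `j` is then the first box to the right of `j` that has
  -- room.
  nearest-bump : ∀ {E j E' k} {U M U' : State} → Ascending E → Balanced E (map proj₁ (U ++ M)) →
    ∀ {c} → U ↭ (j , c) ∷ U' → lo ℤ.≤ j → Bump E j E' k →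
    nearest δ (U' ++ M) (suc (length (U ++ M))) (j ℤ.+ + 1) ≡ k
  nearest-bump {E} {j} {E'} {k} {U} {M} {U'} aE (inWindow , balanced) {c} U↭ lo≤j β
    with t , refl ← ≤⇒+ (<⇒+1≤ (bump-> β)) =
    nearest-spec δ (U' ++ M) _ t (j ℤ.+ + 1) (s≤s t≤) full free
    where
    open ℕₚ.≤-Reasoning
    S : State
    S = U' ++ M

    S↭ : U ++ M ↭ (j , c) ∷ S
    S↭ = ↭ₚ.++⁺ʳ M U↭

    k<hi : k ℤ.< hi
    k<hi = proj₂ (All.lookup inWindow (bump-∈ β))

    j< : ∀ i → j ℤ.< j ℤ.+ + 1 ℤ.+ + i
    j< i = +1≤⇒< (ℤₚ.i≤i+j (j ℤ.+ + 1) (+ i))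

    <k : ∀ {i} → i ℕ.< t → j ℤ.+ + 1 ℤ.+ + i ℤ.< k
    <k i<t = ℤₚ.+-monoʳ-< (j ℤ.+ + 1) (ℤ.+<+ i<t)

    -- The ball taken out of box `j` does not change the count of any box further right, so the
    -- balance before the removal can be used.
    total : ∀ {x} → j ℤ.< x → x ℤ.≤ k → count x E ℕ.+ occ S x ≡ δ x
    total {x} j<x x≤k = begin-equality
      count x E ℕ.+ occ S x                               ≡⟨ cong (count x E ℕ.+_) (occ≡count S x) ⟩
      count x E ℕ.+ count x (map proj₁ S)                 ≡⟨ cong (count x E ℕ.+_) (count-∷-≢ (map proj₁ S) (ℤₚ.<⇒≢ j<x)) ⟨
      count x E ℕ.+ count x (j ∷ map proj₁ S)             ≡⟨ cong (count x E ℕ.+_) (count-↭ x (↭ₚ.map⁺ proj₁ S↭)) ⟨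
      count x E ℕ.+ count x (map proj₁ (U ++ M))          ≡⟨ count-++ x E _ ⟨
      count x (E ++ map proj₁ (U ++ M))                   ≡⟨ balanced x (ℤₚ.≤-trans lo≤j (ℤₚ.<⇒≤ j<x)) (ℤₚ.≤-<-trans x≤k k<hi) ⟩
      δ x                                                 ∎

    full : ∀ i → i ℕ.< t → δ (j ℤ.+ + 1 ℤ.+ + i) ℕ.≤ occ S (j ℤ.+ + 1 ℤ.+ + i)
    full i i<t = ℕₚ.≤-reflexive (sym (subst (λ m → m ℕ.+ occ S x ≡ δ x)
                   (count-All-≢ (All.map none-between (bump-least aE β)))
                   (total (j< i) (ℤₚ.<⇒≤ (<k i<t)))))
      where
      x = j ℤ.+ + 1 ℤ.+ + i
      none-between : ∀ {z} → z ℤ.≤ j ⊎ k ℤ.≤ z → z ≢ x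
      none-between (inj₁ z≤j) refl = ℤₚ.≤⇒≯ z≤j (j< i)
      none-between (inj₂ k≤z) refl = ℤₚ.≤⇒≯ k≤z (<k i<t)

    free : occ S k ℕ.< δ k
    free = begin-strict
      occ S k                 <⟨ ℕₚ.+-monoˡ-≤ (occ S k) (∈⇒count>0 (bump-∈ β)) ⟩
      count k E ℕ.+ occ S k   ≡⟨ total (j< t) ℤₚ.≤-refl ⟩
      δ k                     ∎

    t≤ : t ℕ.≤ length (U ++ M)
    t≤ = begin
      t                       ≤⟨ interval-pigeonhole t (j ℤ.+ + 1) (map proj₁ S) (λ i i<t → count>0⇒∈ _
                                   (subst (0 ℕ.<_) (occ≡count S _) (ℕₚ.≤-trans (δ≥1 _) (full i i<t)))) ⟩
      length (map proj₁ S)    ≡⟨ Listₚ.length-map proj₁ S ⟩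
      length S                ≤⟨ ℕₚ.n≤1+n _ ⟩
      length ((j , c) ∷ S)    ≡⟨ ↭ₚ.↭-length S↭ ⟨
      length (U ++ M)         ∎

  balanced-move : ∀ {E j E' k c} {U M U' : State} → Balanced E (map proj₁ (U ++ M)) →
    U ↭ (j , c) ∷ U' → lo ℤ.≤ j → Bump E j E' k →
    Balanced E' (map proj₁ (U' ++ (k , c) ∷ M))
  balanced-move {E} {j} {E'} {k} {c} {U} {M} {U'} (inWindow , balanced) U↭ lo≤j β =
    ℤI.bump-All inWindow (lo≤j , ℤₚ.<-trans (bump-> β) (proj₂ (All.lookup inWindow (bump-∈ β)))) β ,
    λ x lo≤x x<hi → ≡.trans (count-↭ x slots↭) (balanced x lo≤x x<hi)
    where
    open PermutationReasoning
    slots↭ : E' ++ map proj₁ (U' ++ (k , c) ∷ M) ↭ E ++ map proj₁ (U ++ M)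
    slots↭ = begin
      E' ++ map proj₁ (U' ++ (k , c) ∷ M)  ↭⟨ ↭ₚ.++⁺ˡ E' (↭ₚ.map⁺ proj₁ (↭ₚ.shift (k , c) U' M)) ⟩
      E' ++ k ∷ map proj₁ (U' ++ M)        ↭⟨ ↭ₚ.shift k E' _ ⟩
      k ∷ E' ++ map proj₁ (U' ++ M)        ↭⟨ ↭ₚ.++⁺ʳ _ (bump-↭ β) ⟩
      j ∷ E ++ map proj₁ (U' ++ M)         ↭⟨ ↭ₚ.shift j E _ ⟨
      E ++ j ∷ map proj₁ (U' ++ M)         ↭⟨ ↭ₚ.++⁺ˡ E (↭ₚ.map⁺ proj₁ (↭ₚ.++⁺ʳ M U↭)) ⟨
      E ++ map proj₁ (U ++ M)              ∎

  module _ (J : ℤ) (s : State) (bounded : All (λ b → lo ℤ.≤ proj₁ b × proj₁ b ℤ.≤ J) s)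
           (E₀ : List ℤ) (aE₀ : Ascending E₀) where

    -- Invariant between two moves. `M` grows at its head, as `moved` does, so the carrier sends
    -- each original box to the new box at the same position. `ahead` keeps `moved` sorted when the
    -- next ball joins it, and `enough` reserves one empty slot beyond `J` for each ball still to
    -- move.
    record Reachable (UM : State × State) : Set where
      U = proj₁ UM
      M = proj₂ UM
      field
        {moved}  : List (ℕ × ℤ)
        {E}      : List ℤ
        run      : BiRun E₀ moved (map ×.swap M) E
        perm     : map ×.swap U ++ moved ↭ map ×.swap s
        sorted   : ColorBox.Descending moved
        ahead    : All (λ b → All (ColorBox._⊑ ×.swap b) moved) U
        balanced : Balanced E (map proj₁ (U ++ M))
        enough   : Enough J (length U) E

    unmoved-All : ∀ {P : ℕ × ℤ → Set} {UM} → Reachable UM → All (P ∘ ×.swap) s → All (P ∘ ×.swap) (proj₁ UM)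
    unmoved-All {UM = UM} R ps =
      Allₚ.map⁻ (Allₚ.++⁻ˡ (map ×.swap (proj₁ UM))
        (↭ₚ.All-resp-↭ (↭-sym (Reachable.perm R)) (Allₚ.map⁺ ps)))

    move-reachable : ∀ {c j U M U'} → Reachable (U , M) → All (λ b → c ℕ.≤ proj₂ b) U →
      U ↭ (j , c) ∷ U' → All (λ b → proj₂ b ≡ c → j ℤ.≤ proj₁ b) U →
      Reachable (U' , (nearest δ (U' ++ M) (suc (length (U ++ M))) (j ℤ.+ + 1) , c) ∷ M)
    move-reachable {c} {j} {U} {M} {U'} R c≤ U↭ least
      with (lo≤j , j≤J) ∷ _ ← ↭ₚ.All-resp-↭ U↭ (unmoved-All R bounded)
      with E' , k , β , enough' ← enough⇒bump (subst (λ m → Enough J m (Reachable.E R)) (↭ₚ.↭-length U↭) (Reachable.enough R)) j≤J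
      rewrite nearest-bump (birun-ascending aE₀ (Reachable.run R)) (Reachable.balanced R) U↭ lo≤j β
      with ahead-j ∷ ahead' ← ↭ₚ.All-resp-↭ U↭ (Reachable.ahead R)
      with _ ∷ c≤' ← ↭ₚ.All-resp-↭ U↭ c≤
      with _ ∷ least' ← ↭ₚ.All-resp-↭ U↭ least = record
      { run      = snoc run β
      ; perm     = trans (↭ₚ.shift (c , j) (map ×.swap U') moved)
                     (trans (↭ₚ.++⁺ʳ moved (↭ₚ.map⁺ ×.swap (↭-sym U↭))) perm)
      ; sorted   = ahead-j ∷ sorted
      ; ahead    = All.zipWith (λ (ahead-b , c≤b , j≤b) → next c≤b j≤b ∷ ahead-b)
                     (ahead' , All.zip (c≤' , least'))
      ; balanced = balanced-move balanced U↭ lo≤j β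
      ; enough   = enough' }
      where
      open Reachable R hiding (U; M)
      next : ∀ {d i} → c ℕ.≤ d → (d ≡ c → j ℤ.≤ i) → (c , j) ColorBox.⊑ (d , i)
      next c≤d j≤i with ℕₚ.m≤n⇒m<n∨m≡n c≤d
      ... | inj₁ c<d = inj₁ c<d
      ... | inj₂ refl = inj₂ (refl , j≤i refl)

    moveColor-reachable : ∀ f {c U M} → length U ℕ.≤ f → Reachable (U , M) →
      All (λ b → c ℕ.≤ proj₂ b) U → let UM' = moveColor δ f c (U , M) in
      Reachable UM' × All (λ b → suc c ℕ.≤ proj₂ b) (proj₁ UM')
    moveColor-reachable zero {U = []} _ R _ = R , []
    moveColor-reachable (suc f) {c} {U} {M} U≤f R c≤ with minBoxOfColor c U | minBoxOfColor-leftmost c U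
    ... | nothing | none ≢c = R , All.zipWith (λ (≢c , c≤) → ℕₚ.≤∧≢⇒< c≤ (≢c ∘ sym)) (≢c , c≤)
    ... | just j | some mem least =
      moveColor-reachable f (ℕₚ.≤-pred (subst (ℕ._≤ suc f) (↭ₚ.↭-length U↭) U≤f))
        (move-reachable R c≤ U↭ least) (All.tail (↭ₚ.All-resp-↭ U↭ c≤))
      where
      U↭ : U ↭ (j , c) ∷ removeOne (j , c) U
      U↭ = removeOne-↭ mem

    -- Stated for any `g` that increases by one at each step, because `applyUpTo` recurses by
    -- shifting its function.
    moveColors-reachable : ∀ k (g : ℕ → ℕ) → (∀ i → g (suc i) ≡ suc (g i)) → ∀ {UM} →
      Reachable UM → All (λ b → g 0 ℕ.≤ proj₂ b) (proj₁ UM) →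
      let UM' = foldl (λ UM c → moveColor δ (length (proj₁ UM)) c UM) UM (applyUpTo g k) in
      Reachable UM' × All (λ b → g 0 ℕ.+ k ℕ.≤ proj₂ b) (proj₁ UM')
    moveColors-reachable zero g _ R g≤ = R , All.map (subst (ℕ._≤ _) (sym (ℕₚ.+-identityʳ (g 0)))) g≤
    moveColors-reachable (suc k) g step R g≤ =
      let R₁ , g<  = moveColor-reachable _ ℕₚ.≤-refl R g≤
          R₂ , end = moveColors-reachable k (g ∘ suc) (step ∘ suc) R₁ (All.map (subst (ℕ._≤ _) (sym (step 0))) g<)
      in R₂ , All.map (λ {b} → subst (ℕ._≤ proj₂ b) (≡.trans (cong (ℕ._+ k) (step 0)) (sym (ℕₚ.+-suc (g 0) k)))) end

    evolution : ValidState n δ s → Balanced E₀ (map proj₁ s) → Enough J (length s) E₀ →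
      Carries E₀ s (T n δ s)
    evolution valid balanced enough =
      finish (moveColors-reachable n suc (λ _ → refl) start (All.map proj₁ colors))
      where
      colors : All (λ b → 1 ℕ.≤ proj₂ b × proj₂ b ℕ.≤ n) s
      colors = All.tabulate (ValidState.colorsOk valid)

      start : Reachable (s , [])
      start = record
        { run = [] ; perm = ↭-reflexive (Listₚ.++-identityʳ _) ; sorted = []
        ; ahead = All.universal (λ _ → []) s
        ; balanced = subst (λ S → Balanced E₀ (map proj₁ S)) (sym (Listₚ.++-identityʳ s)) balanced
        ; enough = enough }

      finish : ∀ {UM} → Reachable UM × All (λ b → suc n ℕ.≤ proj₂ b) (proj₁ UM) →
        Carries E₀ s (proj₂ UM)
      finish {[] , _} (R , []) = record { run = Reachable.run R ; perm = Reachable.perm R ; sorted = Reachable.sorted R }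
      -- A ball left over would have a color larger than `n`.
      finish {_ ∷ _ , _} (R , n<c ∷ _) =
        ⊥-elim (ℕₚ.≤⇒≯ (proj₂ (All.head (unmoved-All R colors))) n<c)

-- Empty slots and the initial carrier

applyUpTo-cong : ∀ {A : Set} {f g : ℕ → A} → (∀ i → f i ≡ g i) → ∀ k → applyUpTo f k ≡ applyUpTo g k
applyUpTo-cong f≗g zero = refl
applyUpTo-cong f≗g (suc k) = cong₂ _∷_ (f≗g 0) (applyUpTo-cong (f≗g ∘ suc) k)

rangeℤ-suc : ∀ a k → rangeℤ a (suc k) ≡ a ∷ rangeℤ (a ℤ.+ + 1) k
rangeℤ-suc a k = begin
  rangeℤ a (suc k)                                       ≡⟨ Listₚ.map-upTo _ (suc k) ⟩
  a ℤ.+ + 0 ∷ applyUpTo (λ i → a ℤ.+ + suc i) k          ≡⟨ cong₂ _∷_ (ℤₚ.+-identityʳ a)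
                                                              (applyUpTo-cong (λ i → sym (ℤₚ.+-assoc a (+ 1) (+ i))) k) ⟩
  a ∷ applyUpTo (λ i → a ℤ.+ + 1 ℤ.+ + i) k              ≡⟨ cong (a ∷_) (Listₚ.map-upTo _ k) ⟨
  a ∷ rangeℤ (a ℤ.+ + 1) k                               ∎
  where open ≡.≡-Reasoning

rangeℤ-++ : ∀ a m k → rangeℤ a (m ℕ.+ k) ≡ rangeℤ a m ++ rangeℤ (a ℤ.+ + m) k
rangeℤ-++ a zero k = cong (λ a → rangeℤ a k) (sym (ℤₚ.+-identityʳ a))
rangeℤ-++ a (suc m) k = begin
  rangeℤ a (suc (m ℕ.+ k))                                              ≡⟨ rangeℤ-suc a (m ℕ.+ k) ⟩
  a ∷ rangeℤ (a ℤ.+ + 1) (m ℕ.+ k)                                      ≡⟨ cong (a ∷_) (rangeℤ-++ (a ℤ.+ + 1) m k) ⟩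
  a ∷ rangeℤ (a ℤ.+ + 1) m ++ rangeℤ (a ℤ.+ + 1 ℤ.+ + m) k              ≡⟨ cong₂ (λ xs b → xs ++ rangeℤ b k)
                                                                            (sym (rangeℤ-suc a m)) (ℤₚ.+-assoc a (+ 1) (+ m)) ⟩
  rangeℤ a (suc m) ++ rangeℤ (a ℤ.+ + suc m) k                          ∎
  where open ≡.≡-Reasoning

rangeℤ-∈⁺ : ∀ a {i k} → i ℕ.< k → a ℤ.+ + i ∈ rangeℤ a k
rangeℤ-∈⁺ a i<k = ∈ₚ.∈-map⁺ (λ i → a ℤ.+ + i) (∈ₚ.∈-upTo⁺ i<k)

rangeℤ-bounds : ∀ a k → All (λ z → a ℤ.≤ z × z ℤ.< a ℤ.+ + k) (rangeℤ a k)
rangeℤ-bounds a k = Allₚ.map⁺ (Allₚ.applyUpTo⁺₁ id k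
  (λ {i} i<k → ℤₚ.i≤i+j a (+ i) , ℤₚ.+-monoʳ-< a (ℤ.+<+ i<k)))

rangeℤ-sorted : ∀ a k → AllPairs ℤ._<_ (rangeℤ a k)
rangeℤ-sorted a k = AllPairsₚ.map⁺ (AllPairsₚ.applyUpTo⁺₁ id k (λ i<j _ → ℤₚ.+-monoʳ-< a (ℤ.+<+ i<j)))

minBox≤ : ∀ a s → minBox a s ℤ.≤ a × All (λ b → minBox a s ℤ.≤ proj₁ b) s
minBox≤ a [] = ℤₚ.≤-refl , []
minBox≤ a ((j , _) ∷ s) =
  let ≤a⊓j , ≤s = minBox≤ (a ℤ.⊓ j) s
  in ℤₚ.≤-trans ≤a⊓j (ℤₚ.i⊓j≤i a j) , ℤₚ.≤-trans ≤a⊓j (ℤₚ.i⊓j≤j a j) ∷ ≤s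

maxBox≥ : ∀ a s → a ℤ.≤ maxBox a s × All (λ b → proj₁ b ℤ.≤ maxBox a s) s
maxBox≥ a [] = ℤₚ.≤-refl , []
maxBox≥ a ((j , _) ∷ s) =
  let a⊔j≤ , s≤ = maxBox≥ (a ℤ.⊔ j) s
  in ℤₚ.≤-trans (ℤₚ.i≤i⊔j a j) a⊔j≤ , ℤₚ.≤-trans (ℤₚ.i≤j⊔i a j) a⊔j≤ ∷ s≤

maxBox-sel : ∀ a s → maxBox a s ≡ a ⊎ maxBox a s ∈ map proj₁ s
maxBox-sel a [] = inj₁ refl
maxBox-sel a ((j , _) ∷ s) with maxBox-sel (a ℤ.⊔ j) s
... | inj₂ mem = inj₂ (there mem)
... | inj₁ eq with ℤₚ.⊔-sel a j
...   | inj₁ eq' = inj₁ (≡.trans eq eq')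
...   | inj₂ eq' = inj₂ (here (≡.trans eq eq'))

minList≤ : ∀ a xs → minList a xs ℤ.≤ a
minList≤ a [] = ℤₚ.≤-refl
minList≤ a (x ∷ xs) = ℤₚ.≤-trans (minList≤ (a ℤ.⊓ x) xs) (ℤₚ.i⊓j≤i a x)

maxList≥ : ∀ a xs → a ℤ.≤ maxList a xs × All (ℤ._≤ maxList a xs) xs
maxList≥ a [] = ℤₚ.≤-refl , []
maxList≥ a (x ∷ xs) =
  let a⊔x≤ , xs≤ = maxList≥ (a ℤ.⊔ x) xs
  in ℤₚ.≤-trans (ℤₚ.i≤i⊔j a x) a⊔x≤ , ℤₚ.≤-trans (ℤₚ.i≤j⊔i a x) a⊔x≤ ∷ xs≤

-- Letters are at least every entry of `pre`, so they pass over it; they are at most `J`, so the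
-- reserve in `C₀` stops them before `post`. Since a bump is unique, every step of the given run
-- happens inside `C₀`.
birun-unframe : ∀ {pre C₀ post J L L' C'} m → BiRun (pre ++ C₀ ++ post) L L' C' →
  All (λ b → proj₂ b ℤ.≤ J × All (ℤ._≤ proj₂ b) pre) L → Enough J (m ℕ.+ length L) C₀ →
  ∃[ C₁ ] BiRun {K = ℕ} C₀ L L' C₁ × C' ≡ pre ++ C₁ ++ post × Enough J m C₁
birun-unframe {C₀ = C₀} {J = J} m [] _ en = _ , [] , refl , subst (λ m → Enough J m C₀) (ℕₚ.+-identityʳ m) en
birun-unframe {pre} {C₀} {post} {J} {_ ∷ L} m (snoc ρ β) ((x≤J , pre≤x) ∷ ps) en
  -- The letter processed last is at the head, so the earlier ones must leave one more spare entry
  -- for it.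
  with C₁ , ρ₁ , refl , en₁ ← birun-unframe {pre} {C₀} {post} (suc m) ρ ps (subst (λ m → Enough J m C₀) (ℕₚ.+-suc m (length L)) en)
  with C₂ , y , β₁ , en₂ ← enough⇒bump en₁ x≤J
  with refl , refl ← ℤI.bump-deterministic β (ℤI.++-bump pre pre≤x (ℤI.bump-++ post β₁))
  = C₂ , snoc ρ₁ β₁ , refl , en₂

enough-++ʳ : ∀ {J m} xs {ys} → Enough J m ys → Enough J m (xs ++ ys)
enough-++ʳ {J} {m} xs {ys} en = begin
  m                                                                     ≤⟨ en ⟩
  length (filter (J ℤ.<?_) ys)                                          ≤⟨ ℕₚ.m≤n+m _ (length (filter (J ℤ.<?_) xs)) ⟩
  length (filter (J ℤ.<?_) xs) ℕ.+ length (filter (J ℤ.<?_) ys)         ≡⟨ Listₚ.length-++ (filter (J ℤ.<?_) xs) ⟨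
  length (filter (J ℤ.<?_) xs ++ filter (J ℤ.<?_) ys)                   ≡⟨ cong length (Listₚ.filter-++ (J ℤ.<?_) xs ys) ⟨
  length (filter (J ℤ.<?_) (xs ++ ys))                                  ∎
  where open ℕₚ.≤-Reasoning

emptyBox : (δ : ℤ → ℕ) → State → ℤ → List ℤ
emptyBox δ s j = replicate (δ j ℕ.∸ occ s j) j

emptyBoxes : (δ : ℤ → ℕ) → State → ℤ → ℕ → List ℤ
emptyBoxes δ s a k = concatMap (emptyBox δ s) (rangeℤ a k)

concatMap-rangeℤ-suc : ∀ {A : Set} (f : ℤ → List A) a k →
  concatMap f (rangeℤ a (suc k)) ≡ f a ++ concatMap f (rangeℤ (a ℤ.+ + 1) k)
concatMap-rangeℤ-suc f a k = cong (concatMap f) (rangeℤ-suc a k)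

concatMap-rangeℤ-++ : ∀ {A : Set} (f : ℤ → List A) a m k →
  concatMap f (rangeℤ a (m ℕ.+ k)) ≡ concatMap f (rangeℤ a m) ++ concatMap f (rangeℤ (a ℤ.+ + m) k)
concatMap-rangeℤ-++ f a m k = ≡.trans (cong (concatMap f) (rangeℤ-++ a m k)) (Listₚ.concatMap-++ f (rangeℤ a m) _)

concatMap-All : ∀ {A : Set} {P : A → Set} (f : ℤ → List A) a k →
  (∀ j → a ℤ.≤ j → j ℤ.< a ℤ.+ + k → All P (f j)) → All P (concatMap f (rangeℤ a k))
concatMap-All f a k h = Allₚ.concat⁺ (Allₚ.map⁺ (All.map (λ (p , q) → h _ p q) (rangeℤ-bounds a k)))

module _ (δ : ℤ → ℕ) (δ≥1 : ∀ j → δ j ≥ 1) (s : State) (capacity : ∀ j → occ s j ℕ.≤ δ j) where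

  emptyBoxes-bounds : ∀ a k → All (λ z → a ℤ.≤ z × z ℤ.< a ℤ.+ + k) (emptyBoxes δ s a k)
  emptyBoxes-bounds a k = concatMap-All _ a k (λ j p q → Allₚ.replicate⁺ (δ j ℕ.∸ occ s j) (p , q))

  emptyBoxes-ascending : ∀ a k → Ascending (emptyBoxes δ s a k)
  emptyBoxes-ascending a zero = []
  emptyBoxes-ascending a (suc k) =
    subst Ascending (sym (concatMap-rangeℤ-suc (emptyBox δ s) a k))
      (AllPairsₚ.++⁺ (replicate-ascending (δ a ℕ.∸ occ s a)) (emptyBoxes-ascending (a ℤ.+ + 1) k)
        (Allₚ.replicate⁺ _ (All.map (λ (p , _) → ℤₚ.<⇒≤ (+1≤⇒< p)) (emptyBoxes-bounds (a ℤ.+ + 1) k))))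
    where
    replicate-ascending : ∀ m → Ascending (replicate m a)
    replicate-ascending zero = []
    replicate-ascending (suc m) = Allₚ.replicate⁺ m ℤₚ.≤-refl ∷ replicate-ascending m

  count-emptyBoxes : ∀ a k x → a ℤ.≤ x → x ℤ.< a ℤ.+ + k → count x (emptyBoxes δ s a k) ≡ δ x ℕ.∸ occ s x
  count-emptyBoxes a zero x a≤x x<a = ⊥-elim (ℤₚ.≤⇒≯ a≤x (subst (x ℤ.<_) (ℤₚ.+-identityʳ a) x<a))
  count-emptyBoxes a (suc k) x a≤x x<a+k = begin
    count x (emptyBoxes δ s a (suc k))                       ≡⟨ cong (count x) (concatMap-rangeℤ-suc (emptyBox δ s) a k) ⟩
    count x (emptyBox δ s a ++ rest)                         ≡⟨ count-++ x (emptyBox δ s a) rest ⟩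
    count x (emptyBox δ s a) ℕ.+ count x rest                ≡⟨ cases (LinearOrder.≤⇒<⊎≡ ℤ-order a≤x) ⟩
    δ x ℕ.∸ occ s x                                          ∎
    where
    open ≡.≡-Reasoning
    rest : List ℤ
    rest = emptyBoxes δ s (a ℤ.+ + 1) k
    cases : a ℤ.< x ⊎ a ≡ x → count x (emptyBox δ s a) ℕ.+ count x rest ≡ δ x ℕ.∸ occ s x
    cases (inj₁ a<x) = cong₂ ℕ._+_
      (count-All-≢ (Allₚ.replicate⁺ (δ a ℕ.∸ occ s a) (ℤₚ.<⇒≢ a<x)))
      (count-emptyBoxes (a ℤ.+ + 1) k x (<⇒+1≤ a<x) (subst (x ℤ.<_) (sym (ℤₚ.+-assoc a (+ 1) (+ k))) x<a+k))
    cases (inj₂ refl) = ≡.trans (cong₂ ℕ._+_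
      (≡.trans (cong length (Listₚ.filter-all (ℤ._≟ a) (Allₚ.replicate⁺ (δ a ℕ.∸ occ s a) refl)))
               (Listₚ.length-replicate (δ a ℕ.∸ occ s a)))
      (count-All-≢ (All.map (λ (p , _) z≡a → ℤₚ.<⇒≢ (+1≤⇒< p) (sym z≡a)) (emptyBoxes-bounds (a ℤ.+ + 1) k))))
      (ℕₚ.+-identityʳ _)

  emptyBoxes-balanced : ∀ n a k → Evolution.Balanced n δ δ≥1 a (a ℤ.+ + k) (emptyBoxes δ s a k) (map proj₁ s)
  emptyBoxes-balanced n a k = emptyBoxes-bounds a k , λ x a≤x x<a+k → begin
    count x (emptyBoxes δ s a k ++ map proj₁ s)               ≡⟨ count-++ x (emptyBoxes δ s a k) _ ⟩
    count x (emptyBoxes δ s a k) ℕ.+ count x (map proj₁ s)    ≡⟨ cong₂ ℕ._+_ (count-emptyBoxes a k x a≤x x<a+k) (sym (occ≡count s x)) ⟩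
    δ x ℕ.∸ occ s x ℕ.+ occ s x                               ≡⟨ ℕₚ.m∸n+n≡m (capacity x) ⟩
    δ x                                                       ∎
    where open ≡.≡-Reasoning

  module _ {J : ℤ} (s≤J : All (λ b → proj₁ b ℤ.≤ J) s) where

    occ-beyond : ∀ {j} → J ℤ.< j → occ s j ≡ 0
    occ-beyond J<j = ≡.trans (occ≡count s _)
      (count-All-≢ (Allₚ.map⁺ (All.map (λ i≤J → ℤₚ.<⇒≢ (ℤₚ.≤-<-trans i≤J J<j)) s≤J)))

    -- A box beyond `J` holds no ball and has capacity at least one, so it contributes at least one
    -- label.
    emptyBoxes-beyond : ∀ a k → J ℤ.< a → Enough J k (emptyBoxes δ s a k)
    emptyBoxes-beyond a zero _ = z≤n
    emptyBoxes-beyond a (suc k) J<a =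
      subst (Enough J (suc k)) (sym (concatMap-rangeℤ-suc (emptyBox δ s) a k)) (ready (δ a ℕ.∸ occ s a) positive)
      where
      positive : 1 ℕ.≤ δ a ℕ.∸ occ s a
      positive = subst (λ m → 1 ℕ.≤ δ a ℕ.∸ m) (sym (occ-beyond J<a)) (δ≥1 a)
      rest : List ℤ
      rest = emptyBoxes δ s (a ℤ.+ + 1) k
      ready : ∀ m → 1 ℕ.≤ m → Enough J (suc k) (replicate m a ++ rest)
      ready (suc m) _ rewrite dec-true (J ℤ.<? a) J<a =
        s≤s (enough-++ʳ (replicate m a) (emptyBoxes-beyond (a ℤ.+ + 1) k
              (ℤₚ.<-≤-trans J<a (ℤₚ.i≤i+j a (+ 1)))))

    emptyBoxes-enough : ∀ a t k → J ≡ a ℤ.+ + t → Enough J k (emptyBoxes δ s a (suc t ℕ.+ k))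
    emptyBoxes-enough a t k refl =
      subst (Enough J k)
        (sym (concatMap-rangeℤ-++ (emptyBox δ s) a (suc t) k))
        (enough-++ʳ (emptyBoxes δ s a (suc t)) (emptyBoxes-beyond (a ℤ.+ + suc t) k (ℤₚ.+-monoʳ-< a (ℤ.+<+ ℕₚ.≤-refl))))

-- Numbered slots and the segment between `p` and `q`

Slot : Set
Slot = ℤ × ℤ × Bool

label : Slot → ℤ
label = proj₁ ∘ proj₂

occupied : Slot → Bool
occupied = proj₂ ∘ proj₂

emptyLabels : List Slot → List ℤ
emptyLabels = map label ∘ filter (λ t → occupied t Boolₚ.≟ false)

emptyLabels-++ : ∀ xs ys → emptyLabels (xs ++ ys) ≡ emptyLabels xs ++ emptyLabels ys
emptyLabels-++ xs ys = ≡.trans (cong (map label) (Listₚ.filter-++ _ xs ys)) (Listₚ.map-++ label (filter _ xs) _)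

emptyLabels-All : ∀ {P : ℤ → Set} xs → All (P ∘ label) xs → All P (emptyLabels xs)
emptyLabels-All xs ps = Allₚ.map⁺ (Allₚ.filter⁺ _ ps)

emptyLabels-applyUpTo : ∀ {j m k} (F : ℕ → Slot) → m ℕ.≤ k → (∀ i → label (F i) ≡ j) →
  (∀ i → i ℕ.< m → occupied (F i) ≡ false) → (∀ i → m ℕ.≤ i → occupied (F i) ≡ true) →
  emptyLabels (applyUpTo F k) ≡ replicate m j
emptyLabels-applyUpTo {m = zero} {zero} F _ _ _ _ = refl
emptyLabels-applyUpTo {m = zero} {suc k} F _ lab emp occd
  rewrite occd 0 z≤n = emptyLabels-applyUpTo {k = k} (F ∘ suc) z≤n (lab ∘ suc) (λ _ ()) (λ i _ → occd (suc i) z≤n)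
emptyLabels-applyUpTo {m = suc m} {suc k} F (s≤s m≤k) lab emp occd
  rewrite emp 0 (s≤s z≤n) =
  cong₂ _∷_ (lab 0) (emptyLabels-applyUpTo (F ∘ suc) m≤k (lab ∘ suc)
    (λ i i<m → emp (suc i) (s≤s i<m)) (λ i m≤i → occd (suc i) (s≤s m≤i)))

cut : ∀ p (xs : List Slot) → AllPairs ℤ._<_ (map proj₁ xs) →
      ∃[ ys ] ∃[ zs ] xs ≡ ys ++ zs × All (λ t → proj₁ t ℤ.< p) ys × All (λ t → p ℤ.≤ proj₁ t) zs
cut p [] _ = [] , [] , refl , [] , []
cut p (t ∷ xs) (t< ∷ sorted) with LinearOrder.<-or-≥ ℤ-order (proj₁ t) p
... | inj₂ p≤t = [] , t ∷ xs , refl , [] , p≤t ∷ All.map (λ t<u → ℤₚ.≤-trans p≤t (ℤₚ.<⇒≤ t<u)) (Allₚ.map⁻ t<)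
... | inj₁ t<p with ys , zs , refl , ys< , zs≥ ← cut p xs sorted = t ∷ ys , zs , refl , t<p ∷ ys< , zs≥

-- The initial carrier of s computes to keptLabels p q of the enumerated slots.
kept : ℤ → ℤ → Slot → Bool
kept p q t = not (occupied t) ∧ does (p ℤ.≤? proj₁ t) ∧ does (proj₁ t ℤ.≤? q)

kept-inside : ∀ {p q} t → p ℤ.≤ proj₁ t → proj₁ t ℤ.≤ q → kept p q t ≡ not (occupied t)
kept-inside {p} {q} t p≤ ≤q
  rewrite dec-true (p ℤ.≤? proj₁ t) p≤ | dec-true (proj₁ t ℤ.≤? q) ≤q = Boolₚ.∧-identityʳ _

kept-below : ∀ {p q} t → proj₁ t ℤ.< p → kept p q t ≡ false
kept-below {p} t t<p rewrite dec-false (p ℤ.≤? proj₁ t) (ℤₚ.<⇒≱ t<p) = Boolₚ.∧-zeroʳ _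

kept-above : ∀ {p q} t → q ℤ.< proj₁ t → kept p q t ≡ false
kept-above {p} {q} t q<t rewrite dec-false (proj₁ t ℤ.≤? q) (ℤₚ.<⇒≱ q<t) =
  ≡.trans (cong (not (occupied t) ∧_) (Boolₚ.∧-zeroʳ _)) (Boolₚ.∧-zeroʳ _)

keptLabels : ℤ → ℤ → List Slot → List ℤ
keptLabels p q = map label ∘ filter (λ t → kept p q t Boolₚ.≟ true)

keptLabels-++ : ∀ p q xs ys → keptLabels p q (xs ++ ys) ≡ keptLabels p q xs ++ keptLabels p q ys
keptLabels-++ p q xs ys = ≡.trans (cong (map label) (Listₚ.filter-++ _ xs ys)) (Listₚ.map-++ label (filter _ xs) _)

keptLabels-none : ∀ p q {xs} → All (λ t → kept p q t ≡ false) xs → keptLabels p q xs ≡ []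
keptLabels-none p q ps = cong (map label) (Listₚ.filter-none _ (All.map (λ eq eq' → Boolₚ.not-¬ eq eq') ps))

keptLabels-inside : ∀ p q {xs} → All (λ t → p ℤ.≤ proj₁ t × proj₁ t ℤ.≤ q) xs → keptLabels p q xs ≡ emptyLabels xs
keptLabels-inside p q [] = refl
keptLabels-inside p q {t ∷ xs} ((p≤ , ≤q) ∷ ps) rewrite kept-inside t p≤ ≤q with occupied t
... | true = keptLabels-inside p q ps
... | false = cong (label t ∷_) (keptLabels-inside p q ps)

-- The slots come in increasing order, so restricting them to the interval from `p` to `q` cuts out
-- a contiguous segment.
keptLabels-frame : ∀ p q xs → AllPairs ℤ._<_ (map proj₁ xs) →
  ∃[ ys ] ∃[ zs ] emptyLabels xs ≡ emptyLabels ys ++ keptLabels p q xs ++ zs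
                  × All (_∈ xs) ys × All (λ t → proj₁ t ℤ.< p) ys
keptLabels-frame p q xs sorted
  with A , B , refl , A< , B≥ ← cut p xs sorted
  -- `cut` sends its threshold to the right part; cutting at `q + 1` leaves slot `q` in the middle
  -- part.
  with B , C , refl , B< , C≥ ← cut (q ℤ.+ + 1) B (AllPairs-++ʳ (map proj₁ A) (subst (AllPairs ℤ._<_) (Listₚ.map-++ proj₁ A B) sorted))
  = A , emptyLabels C , split , All.tabulate (∈ₚ.∈-++⁺ˡ) , A<
  where
  open ≡.≡-Reasoning
  <+1⇒≤ : ∀ {i} → i ℤ.< q ℤ.+ + 1 → i ℤ.≤ q
  <+1⇒≤ i< = ℤₚ.≮⇒≥ (λ q<i → ℤₚ.≤⇒≯ (<⇒+1≤ q<i) i<)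
  keptA≡ : keptLabels p q A ≡ []
  keptA≡ = keptLabels-none p q (All.map (λ {t} → kept-below {p} {q} t) A<)
  keptB≡ : keptLabels p q B ≡ emptyLabels B
  keptB≡ = keptLabels-inside p q (All.zipWith (λ (l , r) → l , <+1⇒≤ r) (Allₚ.++⁻ˡ B B≥ , B<))
  keptC≡ : keptLabels p q C ≡ []
  keptC≡ = keptLabels-none p q (All.map (λ {t} le → kept-above {p} t (+1≤⇒< le)) C≥)
  kept≡ : keptLabels p q (A ++ B ++ C) ≡ emptyLabels B
  kept≡ = begin
    keptLabels p q (A ++ B ++ C)                               ≡⟨ keptLabels-++ p q A (B ++ C) ⟩
    keptLabels p q A ++ keptLabels p q (B ++ C)                ≡⟨ cong₂ _++_ keptA≡ (keptLabels-++ p q B C) ⟩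
    keptLabels p q B ++ keptLabels p q C                       ≡⟨ cong₂ _++_ keptB≡ keptC≡ ⟩
    emptyLabels B ++ []                                        ≡⟨ Listₚ.++-identityʳ _ ⟩
    emptyLabels B                                              ∎
  split : emptyLabels (A ++ B ++ C) ≡ emptyLabels A ++ keptLabels p q (A ++ B ++ C) ++ emptyLabels C
  split = begin
    emptyLabels (A ++ B ++ C)                                  ≡⟨ emptyLabels-++ A (B ++ C) ⟩
    emptyLabels A ++ emptyLabels (B ++ C)                      ≡⟨ cong (emptyLabels A ++_) (emptyLabels-++ B C) ⟩
    emptyLabels A ++ emptyLabels B ++ emptyLabels C            ≡⟨ cong (λ xs → emptyLabels A ++ xs ++ emptyLabels C) kept≡ ⟨
    emptyLabels A ++ keptLabels p q (A ++ B ++ C) ++ emptyLabels C ∎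

keptLabels-enough : ∀ {J} p q xs →
  All (λ t → J ℤ.< label t × occupied t ≡ false × p ℤ.≤ proj₁ t) xs →
  Enough J (length (filter (ℤ._≤? q) (map proj₁ xs))) (keptLabels p q xs)
keptLabels-enough p q [] [] = z≤n
keptLabels-enough {J} p q (t ∷ xs) ((J< , emp , p≤) ∷ ps) with proj₁ t ℤ.≤? q
... | no _ rewrite emp | dec-true (p ℤ.≤? proj₁ t) p≤ = keptLabels-enough p q xs ps
... | yes _ rewrite emp | dec-true (p ℤ.≤? proj₁ t) p≤ | dec-true (J ℤ.<? label t) J< =
  s≤s (keptLabels-enough p q xs ps)

module Slots (δ : ℤ → ℕ) (δ≥1 : ∀ j → δ j ≥ 1) (d : ℤ → ℤ) (boundary : IsSlotBoundary δ d)
             (s : State) (capacity : ∀ j → occ s j ℕ.≤ δ j) where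

  d-step : ∀ j → d j ≡ d (j ℤ.- + 1) ℤ.+ + δ j
  d-step j = ≡.trans (lemma (d j) (d (j ℤ.- + 1))) (cong (ℤ._+_ (d (j ℤ.- + 1))) (boundary j))
    where
    lemma : ∀ x y → x ≡ y ℤ.+ (x ℤ.- y)
    lemma = solve-∀

  +1-1 : ∀ j → j ℤ.+ + 1 ℤ.- + 1 ≡ j
  +1-1 = solve-∀

  d-mono : ∀ {i j} → i ℤ.≤ j → d i ℤ.≤ d j
  d-mono {i} i≤j with t , refl ← ≤⇒+ i≤j = go t
    where
    go : ∀ t → d i ℤ.≤ d (i ℤ.+ + t)
    go zero = ℤₚ.≤-reflexive (cong d (sym (ℤₚ.+-identityʳ i)))
    go (suc t) = begin
      d i                                                ≤⟨ go t ⟩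
      d (i ℤ.+ + t)                                      ≡⟨ cong d (lemma i (+ t)) ⟩
      d (i ℤ.+ + suc t ℤ.- + 1)                          ≤⟨ ℤₚ.i≤i+j _ (+ δ (i ℤ.+ + suc t)) ⟩
      d (i ℤ.+ + suc t ℤ.- + 1) ℤ.+ + δ (i ℤ.+ + suc t)  ≡⟨ d-step _ ⟨
      d (i ℤ.+ + suc t)                                  ∎
      where
      open ℤₚ.≤-Reasoning
      lemma : ∀ i t → i ℤ.+ t ≡ i ℤ.+ (+ 1 ℤ.+ t) ℤ.- + 1
      lemma = solve-∀

  d-cancel-< : ∀ {i j} → d i ℤ.< d j → i ℤ.< j
  d-cancel-< di<dj = ℤₚ.≰⇒> (λ j≤i → ℤₚ.<⇒≱ di<dj (d-mono j≤i))

  slots : ℤ → ℕ → List Slot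
  slots a k = concatMap (boxSlots d δ s) (rangeℤ a k)

  InBox : ℤ → Slot → Set
  InBox j t = label t ≡ j × d (j ℤ.- + 1) ℤ.< proj₁ t × proj₁ t ℤ.≤ d j
              × occupied t ≡ does ((d j ℤ.- + occ s j) ℤ.<? proj₁ t)

  boxSlots-inBox : ∀ j → All (InBox j) (boxSlots d δ s j)
  boxSlots-inBox j = Allₚ.map⁺ (All.map (λ (l , u) → refl , +1≤⇒< l , upper u , refl) (rangeℤ-bounds (d (j ℤ.- + 1) ℤ.+ + 1) (δ j)))
    where
    lemma : ∀ x y → x ℤ.+ + 1 ℤ.+ y ≡ x ℤ.+ y ℤ.+ + 1
    lemma = solve-∀
    upper : ∀ {i} → i ℤ.< d (j ℤ.- + 1) ℤ.+ + 1 ℤ.+ + δ j → i ℤ.≤ d j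
    upper {i} u = ℤₚ.≮⇒≥ (λ dj<i → ℤₚ.≤⇒≯ (<⇒+1≤ dj<i)
      (subst (i ℤ.<_) (≡.trans (lemma (d (j ℤ.- + 1)) (+ δ j)) (cong (ℤ._+ + 1) (sym (d-step j)))) u))

  boxSlots-emptyLabels : ∀ j → emptyLabels (boxSlots d δ s j) ≡ emptyBox δ s j
  boxSlots-emptyLabels j = begin
    emptyLabels (boxSlots d δ s j)         ≡⟨ cong emptyLabels (≡.trans (sym (Listₚ.map-∘ (upTo (δ j)))) (Listₚ.map-upTo F (δ j))) ⟩
    emptyLabels (applyUpTo F (δ j))        ≡⟨ emptyLabels-applyUpTo F (ℕₚ.m∸n≤m (δ j) (occ s j)) (λ _ → refl)
                                               (λ i i<m → dec-false (_ ℤ.<? _) (below i i<m))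
                                               (λ i m≤i → dec-true (_ ℤ.<? _) (above i m≤i)) ⟩
    emptyBox δ s j                         ∎
    where
    open ≡.≡-Reasoning
    open ≡ using (subst₂)
    x : ℤ
    x = d (j ℤ.- + 1)
    m : ℕ
    m = δ j ℕ.∸ occ s j
    F : ℕ → Slot
    F i = x ℤ.+ + 1 ℤ.+ + i , j , does ((d j ℤ.- + occ s j) ℤ.<? (x ℤ.+ + 1 ℤ.+ + i))
    slot≡ : ∀ i → x ℤ.+ + 1 ℤ.+ + i ≡ x ℤ.+ + suc i
    slot≡ i = ℤₚ.+-assoc x (+ 1) (+ i)
    lemma : ∀ x m o → x ℤ.+ (m ℤ.+ o) ℤ.- o ≡ x ℤ.+ m
    lemma = solve-∀
    threshold : d j ℤ.- + occ s j ≡ x ℤ.+ + m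
    threshold = begin
      d j ℤ.- + occ s j                             ≡⟨ cong (ℤ._- + occ s j) (d-step j) ⟩
      x ℤ.+ + δ j ℤ.- + occ s j                     ≡⟨ cong (λ n → x ℤ.+ + n ℤ.- + occ s j) (ℕₚ.m∸n+n≡m (capacity j)) ⟨
      x ℤ.+ (+ m ℤ.+ + occ s j) ℤ.- + occ s j       ≡⟨ lemma x (+ m) (+ occ s j) ⟩
      x ℤ.+ + m                                     ∎
    below : ∀ i → i ℕ.< m → ¬ (d j ℤ.- + occ s j ℤ.< x ℤ.+ + 1 ℤ.+ + i)
    below i i<m = ℤₚ.≤⇒≯ (subst₂ ℤ._≤_ (sym (slot≡ i)) (sym threshold) (ℤₚ.+-monoʳ-≤ x (ℤ.+≤+ i<m)))
    above : ∀ i → m ℕ.≤ i → d j ℤ.- + occ s j ℤ.< x ℤ.+ + 1 ℤ.+ + i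
    above i m≤i = subst₂ ℤ._<_ (sym threshold) (sym (slot≡ i)) (ℤₚ.+-monoʳ-< x (ℤ.+<+ (s≤s m≤i)))

  slots-emptyLabels : ∀ a k → emptyLabels (slots a k) ≡ emptyBoxes δ s a k
  slots-emptyLabels a k = go (rangeℤ a k)
    where
    go : ∀ js → emptyLabels (concatMap (boxSlots d δ s) js) ≡ concatMap (emptyBox δ s) js
    go [] = refl
    go (j ∷ js) = ≡.trans (emptyLabels-++ (boxSlots d δ s j) _) (cong₂ _++_ (boxSlots-emptyLabels j) (go js))

  boxSlots-numbers : ∀ j → map proj₁ (boxSlots d δ s j) ≡ rangeℤ (d (j ℤ.- + 1) ℤ.+ + 1) (δ j)
  boxSlots-numbers j = ≡.trans (sym (Listₚ.map-∘ (rangeℤ (d (j ℤ.- + 1) ℤ.+ + 1) (δ j)))) (Listₚ.map-id _)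

  -- The witness `w` is the total capacity of the boxes, at least `k` because each box has a slot.
  slots-numbers : ∀ a k → ∃[ w ] k ℕ.≤ w × map proj₁ (slots a k) ≡ rangeℤ (d (a ℤ.- + 1) ℤ.+ + 1) w
  slots-numbers a zero = 0 , z≤n , refl
  slots-numbers a (suc k) with w , k≤w , eq ← slots-numbers (a ℤ.+ + 1) k =
    δ a ℕ.+ w , ℕₚ.+-mono-≤ (δ≥1 a) k≤w , (begin
    map proj₁ (slots a (suc k))                                       ≡⟨ cong (map proj₁) (concatMap-rangeℤ-suc (boxSlots d δ s) a k) ⟩
    map proj₁ (boxSlots d δ s a ++ slots (a ℤ.+ + 1) k)               ≡⟨ Listₚ.map-++ proj₁ (boxSlots d δ s a) _ ⟩
    map proj₁ (boxSlots d δ s a) ++ map proj₁ (slots (a ℤ.+ + 1) k)   ≡⟨ cong₂ _++_ (boxSlots-numbers a) eq ⟩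
    rangeℤ x (δ a) ++ rangeℤ (d (a ℤ.+ + 1 ℤ.- + 1) ℤ.+ + 1) w        ≡⟨ cong (λ y → rangeℤ x (δ a) ++ rangeℤ y w) next ⟩
    rangeℤ x (δ a) ++ rangeℤ (x ℤ.+ + δ a) w                          ≡⟨ rangeℤ-++ x (δ a) w ⟨
    rangeℤ x (δ a ℕ.+ w)                                              ∎)
    where
    open ≡.≡-Reasoning
    x : ℤ
    x = d (a ℤ.- + 1) ℤ.+ + 1
    lemma : ∀ x y → x ℤ.+ y ℤ.+ + 1 ≡ x ℤ.+ + 1 ℤ.+ y
    lemma = solve-∀
    next : d (a ℤ.+ + 1 ℤ.- + 1) ℤ.+ + 1 ≡ x ℤ.+ + δ a
    next = begin
      d (a ℤ.+ + 1 ℤ.- + 1) ℤ.+ + 1           ≡⟨ cong (λ j → d j ℤ.+ + 1) (+1-1 a) ⟩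
      d a ℤ.+ + 1                             ≡⟨ cong (ℤ._+ + 1) (d-step a) ⟩
      d (a ℤ.- + 1) ℤ.+ + δ a ℤ.+ + 1         ≡⟨ lemma (d (a ℤ.- + 1)) (+ δ a) ⟩
      x ℤ.+ + δ a                             ∎

  slots-sorted : ∀ a k → AllPairs ℤ._<_ (map proj₁ (slots a k))
  slots-sorted a k with w , _ , eq ← slots-numbers a k = subst (AllPairs ℤ._<_) (sym eq) (rangeℤ-sorted (d (a ℤ.- + 1) ℤ.+ + 1) w)

  slots-All : ∀ {P : Slot → Set} a k → (∀ j → a ℤ.≤ j → j ℤ.< a ℤ.+ + k → ∀ {t} → InBox j t → P t) →
              All P (slots a k)
  slots-All a k h = concatMap-All _ a k (λ j l u → All.map (h j l u) (boxSlots-inBox j))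

  -- The `k` slots directly after `d J` are empty, lie in the `k` boxes after `J`, and are numbered
  -- at most `q`. With `k` the number of balls, this is why `q` is the last occupied slot plus `N`.
  beyond-enough : ∀ {J} → All (λ b → proj₁ b ℤ.≤ J) s → ∀ p q k → p ℤ.≤ d J → d J ℤ.+ + k ℤ.≤ q →
    Enough J k (keptLabels p q (slots (J ℤ.+ + 1) k))
  beyond-enough {J} s≤J p q k p≤ ≤q with w , k≤w , eq ← slots-numbers (J ℤ.+ + 1) k = ℕₚ.≤-trans k≤
    (keptLabels-enough p q (slots (J ℤ.+ + 1) k) (slots-All (J ℤ.+ + 1) k conditions))
    where
    x : ℤ
    x = d (J ℤ.+ + 1 ℤ.- + 1) ℤ.+ + 1

    conditions : ∀ j → J ℤ.+ + 1 ℤ.≤ j → j ℤ.< J ℤ.+ + 1 ℤ.+ + k → ∀ {t} → InBox j t →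
                 J ℤ.< label t × occupied t ≡ false × p ℤ.≤ proj₁ t
    conditions j J< _ {t} (refl , l , u , occ≡) =
      +1≤⇒< J< ,
      ≡.trans occ≡ (dec-false (_ ℤ.<? _) (ℤₚ.≤⇒≯
        (subst (λ o → proj₁ t ℤ.≤ d j ℤ.- + o) (sym (occ-beyond δ δ≥1 s capacity s≤J (+1≤⇒< J<)))
          (subst (proj₁ t ℤ.≤_) (sym (ℤₚ.+-identityʳ (d j))) u)))) ,
      ℤₚ.≤-trans p≤ (ℤₚ.≤-trans (d-mono (subst (ℤ._≤ j ℤ.- + 1) (+1-1 J) (ℤₚ.+-monoˡ-≤ (ℤ.- + 1) J<))) (ℤₚ.<⇒≤ l))

    within : ∀ {i} → i ℤ.< x ℤ.+ + k → i ℤ.≤ q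
    within {i} i< = ℤₚ.≤-trans (ℤₚ.≮⇒≥ (λ lt → ℤₚ.≤⇒≯ (<⇒+1≤ lt) (subst (i ℤ.<_) end≡ i<))) ≤q
      where
      lemma : ∀ x y → x ℤ.+ + 1 ℤ.+ y ≡ x ℤ.+ y ℤ.+ + 1
      lemma = solve-∀
      end≡ : x ℤ.+ + k ≡ d J ℤ.+ + k ℤ.+ + 1
      end≡ = ≡.trans (cong (λ j → d j ℤ.+ + 1 ℤ.+ + k) (+1-1 J)) (lemma (d J) (+ k))

    k≤ : k ℕ.≤ length (filter (ℤ._≤? q) (map proj₁ (slots (J ℤ.+ + 1) k)))
    k≤ with r , refl ← ℕₚ.m≤n⇒∃[o]m+o≡n k≤w = begin
      k                                                          ≡⟨ ≡.trans (Listₚ.length-map (λ i → x ℤ.+ + i) (upTo k)) (Listₚ.length-upTo k) ⟨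
      length (rangeℤ x k)                                        ≡⟨ cong length (Listₚ.filter-all (ℤ._≤? q) (All.map (within ∘ proj₂) (rangeℤ-bounds x k))) ⟨
      length (filter (ℤ._≤? q) (rangeℤ x k))                     ≤⟨ ℕₚ.m≤m+n _ _ ⟩
      length (filter (ℤ._≤? q) (rangeℤ x k)) ℕ.+ length (filter (ℤ._≤? q) (rangeℤ (x ℤ.+ + k) r))
                                                                 ≡⟨ Listₚ.length-++ (filter (ℤ._≤? q) (rangeℤ x k)) ⟨
      length (filter (ℤ._≤? q) (rangeℤ x k) ++ filter (ℤ._≤? q) (rangeℤ (x ℤ.+ + k) r))
                                                                 ≡⟨ cong length (Listₚ.filter-++ (ℤ._≤? q) (rangeℤ x k) _) ⟨
      length (filter (ℤ._≤? q) (rangeℤ x k ++ rangeℤ (x ℤ.+ + k) r))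
                                                                 ≡⟨ cong (length ∘ filter (ℤ._≤? q)) (≡.trans eq (rangeℤ-++ x k r)) ⟨
      length (filter (ℤ._≤? q) (map proj₁ (slots (J ℤ.+ + 1) k))) ∎
      where open ℕₚ.≤-Reasoning

  occupiedSlots : List Slot → List ℤ
  occupiedSlots = map proj₁ ∘ filter (λ t → occupied t Boolₚ.≟ true)

  last-slot : ∀ j → d j ∈ map proj₁ (boxSlots d δ s j)
  last-slot j rewrite boxSlots-numbers j with δ j | δ≥1 j | d-step j
  ... | suc m | _ | eq = subst (_∈ rangeℤ (d (j ℤ.- + 1) ℤ.+ + 1) (suc m)) (sym (≡.trans eq (lemma (d (j ℤ.- + 1)) (+ m))))
                         (rangeℤ-∈⁺ (d (j ℤ.- + 1) ℤ.+ + 1) ℕₚ.≤-refl)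
    where
    lemma : ∀ x n → x ℤ.+ (+ 1 ℤ.+ n) ≡ x ℤ.+ + 1 ℤ.+ n
    lemma = solve-∀

  threshold<last : ∀ {j} → j ∈ map proj₁ s → d j ℤ.- + occ s j ℤ.< d j
  threshold<last {j} ball with occ s j | subst (0 ℕ.<_) (sym (occ≡count s j)) (∈⇒count>0 ball)
  ... | suc o | _ = subst (d j ℤ.- + suc o ℤ.<_) (ℤₚ.+-identityʳ (d j)) (ℤₚ.+-monoʳ-< (d j) ℤ.-<+)

  -- Balls are packed to the right, so a box with a ball has its last slot occupied. For the last
  -- occupied box this bounds `q` from below.
  last-slot-occupied : ∀ {a k j} → j ∈ map proj₁ s → j ∈ rangeℤ a k → d j ∈ occupiedSlots (slots a k)
  last-slot-occupied {a} {k} {j} ball j∈ with t , t∈ , dj≡ ← ∈ₚ.∈-map⁻ proj₁ (last-slot j) =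
    subst (_∈ occupiedSlots (slots a k)) (sym dj≡)
      (∈ₚ.∈-map⁺ proj₁ (∈ₚ.∈-filter⁺ (λ t → occupied t Boolₚ.≟ true)
        (∈ₚ.∈-concat⁺′ t∈ (∈ₚ.∈-map⁺ (boxSlots d δ s) j∈)) occd))
    where
    occd : occupied t ≡ true
    occd = ≡.trans (proj₂ (proj₂ (proj₂ (All.lookup (boxSlots-inBox j) t∈))))
      (dec-true (_ ℤ.<? _) (subst (d j ℤ.- + occ s j ℤ.<_) dj≡ (threshold<last ball)))

-- Time evolution of the tableaux

-- Balls of one color land in weakly increasing boxes, by monotonicity of bumps. The moved balls, as
-- listed, are therefore already in the order that `RSK⇒rows` asks for.
birun-descending : ∀ {C L L' C'} → Ascending C → BiRun C L L' C' → ColorBox.Descending L → ColorBox.Descending L'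
birun-descending _ [] _ = []
birun-descending aC (snoc ρ β) (dx ∷ d) = next ρ d dx β ∷ birun-descending aC ρ d
  where
  next : ∀ {L L' C₁ k x C₂ x'} → BiRun _ L L' C₁ → ColorBox.Descending L → All (ColorBox._⊑ (k , x)) L →
         Bump C₁ x C₂ x' → All (ColorBox._⊑ (k , x')) L'
  next [] _ _ _ = []
  next (snoc ρ β₀) (dx₀ ∷ d) (le ∷ _) β =
    step le ∷ All.map (λ le' → ColorBox.⊑-trans le' (step le)) (next ρ d dx₀ β₀)
    where
    step : ∀ {k₀ k} → (k₀ , _) ColorBox.⊑ (k , _) → (k₀ , _) ColorBox.⊑ (k , _)
    step (inj₁ k₀<k) = inj₁ k₀<k
    step (inj₂ (eq , x₀≤x)) = inj₂ (eq , ℤI.bump-monotone (birun-ascending aC ρ) β₀ β x₀≤x)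

module _ {C s s'} (aC : Ascending C) (K : Carries C s s') where
  open Carries K

  private
    rows : ℤI.Rows moved (Qsym s) (Psym s)
    rows = RSK⇒rows {s} perm sorted

    rows' : ℤI.Rows (map ×.swap s') (Qsym s') (Psym s')
    rows' = RSK⇒rows {s'} refl (birun-descending aC run sorted)

    rows-equal : ∃[ P ] ℤI.Rows (map ×.swap s') P (Psym s) × Run C (W (Qsym s)) (W P) C' →
                 Psym s ≡ Psym s' × Run C (W (Qsym s)) (W (Qsym s')) C'
    rows-equal (_ , R , ρ) with refl , eq ← ℤI.rows-deterministic R rows' = eq , ρ

    carried : Psym s ≡ Psym s' × Run C (W (Qsym s)) (W (Qsym s')) C'
    carried = rows-equal (rows-carrier aC run rows)

  carries-Psym : Psym s' ≡ Psym s
  carries-Psym = sym (proj₁ carried)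

  carries-Qsym : Run C (W (Qsym s)) (W (Qsym s')) C'
  carries-Qsym = proj₂ carried

  carries-shape : map length (Qsym s') ≡ map length (Qsym s)
  carries-shape = begin
    map length (Qsym s') ≡⟨ ℤI.rows-shape rows' ⟩
    map length (Psym s') ≡⟨ cong (map length) carries-Psym ⟩
    map length (Psym s)  ≡⟨ ℤI.rows-shape rows ⟨
    map length (Qsym s)  ∎
    where open ≡.≡-Reasoning

  -- The letters inserted are the boxes of the balls, so `Qsym s` determines how many balls each box
  -- holds, and with it the empty slots.
  Qsym-boxes : concat (Qsym s) ↭ map proj₁ s
  Qsym-boxes = trans (ℤI.rows-↭ rows) (trans (↭ₚ.map⁺ proj₂ perm) (↭-reflexive (sym (Listₚ.map-∘ s))))

-- Equal carriers and equal input words give equal output words. The shapes agree as well, since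
-- each step preserves the shape of the Q-symbol, so `W-injective` applies.
carries-autonomous : ∀ {C s₁ s₁' s₂ s₂'} → Ascending C → Carries C s₁ s₁' → Carries C s₂ s₂' →
                     Qsym s₁ ≡ Qsym s₂ → Qsym s₁' ≡ Qsym s₂'
carries-autonomous {C} {s₂ = s₂} {s₂' = s₂'} aC K₁ K₂ Q≡ = W-injective _ _
  (≡.trans (carries-shape aC K₁) (≡.trans (cong (map length) Q≡) (sym (carries-shape aC K₂))))
  (run-deterministic (carries-Qsym aC K₁)
    (subst (λ Q → Run C (W Q) (W (Qsym s₂')) (Carries.C' K₂)) (sym Q≡) (carries-Qsym aC K₂)))

carries-unframe : ∀ {pre C₀ post s s' J} → Carries (pre ++ C₀ ++ post) s s' →
  All (λ j → j ℤ.≤ J × All (ℤ._≤ j) pre) (map proj₁ s) → Enough J (length s) C₀ → Carries C₀ s s'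
carries-unframe {pre} {C₀} {post} {s} {s'} {J} K bounds enough = from
  (birun-unframe {pre} {C₀} {post} 0 run
    (↭ₚ.All-resp-↭ (↭-sym perm) (Allₚ.map⁺ (Allₚ.map⁻ bounds)))
    (subst (λ m → Enough J m C₀) (sym (≡.trans (↭ₚ.↭-length perm) (Listₚ.length-map ×.swap s))) enough))
  where
  open Carries K
  from : ∃[ C₁ ] BiRun C₀ moved (map ×.swap s') C₁ × C' ≡ pre ++ C₁ ++ post × Enough J 0 C₁ → Carries C₀ s s'
  from (_ , run₀ , _) = record { run = run₀ ; perm = perm ; sorted = sorted }

-- The three claims

module _ (n : ℕ) (δ : ℤ → ℕ) (δ≥1 : ∀ j → δ j ≥ 1) where
  open ValidState

  module _ {s} (valid : ValidState n δ s) (lo : ℤ) (t : ℕ) where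

    -- Boxes `lo` to `lo + t` are to contain all balls; each of the `length s` boxes after them
    -- offers a slot for one move. `initialCarrier` enumerates the same range.
    initialSlots : List ℤ
    initialSlots = emptyBoxes δ s lo (suc t ℕ.+ length s)

    initialSlots-ascending : Ascending initialSlots
    initialSlots-ascending = emptyBoxes-ascending δ δ≥1 s (capacityOk valid) lo (suc t ℕ.+ length s)

    time-step : All (λ j → lo ℤ.≤ j × j ℤ.≤ lo ℤ.+ + t) (map proj₁ s) → Carries initialSlots s (T n δ s)
    time-step bounds =
      Evolution.evolution n δ δ≥1 lo (lo ℤ.+ + k) (lo ℤ.+ + t) s (Allₚ.map⁻ bounds)
        initialSlots initialSlots-ascending valid
        (emptyBoxes-balanced δ δ≥1 s (capacityOk valid) n lo k)
        (emptyBoxes-enough δ δ≥1 s (capacityOk valid) (All.map proj₂ (Allₚ.map⁻ bounds)) lo t (length s) refl)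
      where
      k : ℕ
      k = suc t ℕ.+ length s

  span : ℤ → State → ℕ
  span a s = ℤ.∣ maxBox a s ℤ.- minBox a s ∣

  maxBox≡ : ∀ a s → maxBox a s ≡ minBox a s ℤ.+ + span a s
  maxBox≡ a s = proj₂ (≤⇒+ (ℤₚ.≤-trans (proj₁ (minBox≤ a s)) (proj₁ (maxBox≥ a s))))

  boxes-bounds : ∀ a s → All (λ j → minBox a s ℤ.≤ j × j ℤ.≤ minBox a s ℤ.+ + span a s) (map proj₁ s)
  boxes-bounds a s = Allₚ.map⁺ (All.zipWith
    (λ (l , u) → l , ℤₚ.≤-trans u (ℤₚ.≤-reflexive (maxBox≡ a s))) (proj₂ (minBox≤ a s) , proj₂ (maxBox≥ a s)))

  P-conserved : ∀ s → ValidState n δ s → Psym (T n δ s) ≡ Psym s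
  P-conserved s valid =
    carries-Psym (initialSlots-ascending valid lo t) (time-step valid lo t (boxes-bounds (+ 0) s))
    where
    -- Box 0 is a default that gives the empty state a window; for other states it can only widen
    -- the window.
    lo = minBox (+ 0) s
    t = span (+ 0) s

  Q-autonomous : ∀ s₁ s₂ → ValidState n δ s₁ → ValidState n δ s₂ →
                 Qsym s₁ ≡ Qsym s₂ → Qsym (T n δ s₁) ≡ Qsym (T n δ s₂)
  Q-autonomous s₁ s₂ valid₁ valid₂ Q≡ = carries-autonomous ascending₁ K₁ K₂ Q≡
    where
    lo : ℤ
    lo = minBox (+ 0) s₁
    t : ℕ
    t = span (+ 0) s₁
    ascending₁ : Ascending (initialSlots valid₁ lo t)
    ascending₁ = initialSlots-ascending valid₁ lo t
    K₁ : Carries (initialSlots valid₁ lo t) s₁ (T n δ s₁)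
    K₁ = time-step valid₁ lo t (boxes-bounds (+ 0) s₁)
    boxes↭ : map proj₁ s₁ ↭ map proj₁ s₂
    boxes↭ = begin
      map proj₁ s₁      ↭⟨ Qsym-boxes ascending₁ K₁ ⟨
      concat (Qsym s₁)  ≡⟨ cong concat Q≡ ⟩
      concat (Qsym s₂)  ↭⟨ Qsym-boxes (initialSlots-ascending valid₂ (minBox (+ 0) s₂) (span (+ 0) s₂))
                             (time-step valid₂ _ _ (boxes-bounds (+ 0) s₂)) ⟩
      map proj₁ s₂      ∎
      where open PermutationReasoning
    length≡ : length s₁ ≡ length s₂
    length≡ = ≡.trans (sym (Listₚ.length-map proj₁ s₁)) (≡.trans (↭ₚ.↭-length boxes↭) (Listₚ.length-map proj₁ s₂))
    occ-≡ : ∀ j → occ s₁ j ≡ occ s₂ j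
    occ-≡ j = ≡.trans (occ≡count s₁ j) (≡.trans (count-↭ j boxes↭) (sym (occ≡count s₂ j)))
    initialSlots≡ : initialSlots valid₁ lo t ≡ initialSlots valid₂ lo t
    initialSlots≡ = ≡.trans
      (cong (λ N → emptyBoxes δ s₁ lo (suc t ℕ.+ N)) length≡)
      (Listₚ.concatMap-cong (λ j → cong (λ m → replicate (δ j ℕ.∸ m) j) (occ-≡ j)) (rangeℤ lo (suc t ℕ.+ length s₂)))
    -- The second state evolves in the window of the first: its balls occupy the same boxes, so they
    -- lie in that window and leave the same slots empty.
    K₂ : Carries (initialSlots valid₁ lo t) s₂ (T n δ s₂)
    K₂ = subst (λ C → Carries C s₂ (T n δ s₂)) (sym initialSlots≡)
           (time-step valid₂ lo t (↭ₚ.All-resp-↭ boxes↭ (boxes-bounds (+ 0) s₁)))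

  module _ (d : ℤ → ℤ) (boundary : IsSlotBoundary δ d) (j₀ : ℤ) (c₀ : ℕ) (s' : State)
           (valid : ValidState n δ ((j₀ , c₀) ∷ s')) where
    private
      s : State
      s = (j₀ , c₀) ∷ s'
      N : ℕ
      N = length s
      open Slots δ δ≥1 d boundary s (capacityOk valid)
      lo J : ℤ
      lo = minBox j₀ s
      J = lo ℤ.+ + span j₀ s
      k : ℕ
      k = suc (span j₀ s) ℕ.+ N
      occd : List ℤ
      occd = occupiedSlots (slots lo k)
      p q : ℤ
      p = minList (d lo) occd
      q = maxList (d lo) occd ℤ.+ + N

      p≤ : p ℤ.≤ d lo
      p≤ = minList≤ (d lo) occd

      J-ball : J ∈ map proj₁ s
      J-ball with maxBox-sel j₀ s
      ... | inj₁ eq = here (≡.trans (sym (maxBox≡ j₀ s)) eq)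
      ... | inj₂ mem = subst (_∈ map proj₁ s) (maxBox≡ j₀ s) mem

      q≥ : d J ℤ.+ + N ℤ.≤ q
      q≥ = ℤₚ.+-monoˡ-≤ (+ N) (All.lookup (proj₂ (maxList≥ (d lo) occd))
              (last-slot-occupied {lo} {k} J-ball (rangeℤ-∈⁺ lo (s≤s (ℕₚ.m≤m+n (span j₀ s) N)))))

      slots-split : slots lo k ≡ slots lo (suc (span j₀ s)) ++ slots (J ℤ.+ + 1) N
      slots-split = ≡.trans (concatMap-rangeℤ-++ (boxSlots d δ s) lo (suc (span j₀ s)) N)
        (cong (λ a → slots lo (suc (span j₀ s)) ++ slots a N) (lemma lo (+ span j₀ s)))
        where
        lemma : ∀ a t → a ℤ.+ (+ 1 ℤ.+ t) ≡ a ℤ.+ t ℤ.+ + 1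
        lemma = solve-∀

    Frame : List ℤ → Set
    Frame E = ∃[ pre ] ∃[ post ] E ≡ pre ++ initialCarrier d δ s ++ post × All (ℤ._≤ lo) pre

    -- A slot before `p` lies before the last slot of box `lo`, so its label is at most `lo` and
    -- hence at most the box of any ball.
    initialCarrier-frame : Frame (initialSlots valid lo (span j₀ s))
    initialCarrier-frame
      with A , post , eq , A∈ , A< ← keptLabels-frame p q (slots lo k) (slots-sorted lo k)
      = emptyLabels A , post , ≡.trans (sym (slots-emptyLabels lo k)) eq ,
        emptyLabels-All A (All.zipWith (λ {t} (t∈ , t<p) → label≤ {t} (All.lookup slots> t∈) t<p) (A∈ , A<))
      where
      slots> : All (λ t → d (label t ℤ.- + 1) ℤ.< proj₁ t) (slots lo k)
      slots> = slots-All lo k (λ { _ _ _ (refl , l , _) → l })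
      cancel : ∀ i → i ℤ.- + 1 ℤ.+ + 1 ≡ i
      cancel = solve-∀
      label≤ : ∀ {t} → d (label t ℤ.- + 1) ℤ.< proj₁ t → proj₁ t ℤ.< p → label t ℤ.≤ lo
      label≤ {t} l t<p = subst (ℤ._≤ lo) (cancel (label t))
        (<⇒+1≤ (d-cancel-< (ℤₚ.<-≤-trans (ℤₚ.<-trans l t<p) p≤)))

    initialCarrier-enough : Enough J N (initialCarrier d δ s)
    initialCarrier-enough = subst (Enough J N)
      (sym (≡.trans (cong (keptLabels p q) slots-split) (keptLabels-++ p q (slots lo (suc (span j₀ s))) (slots (J ℤ.+ + 1) N))))
      (enough-++ʳ (keptLabels p q (slots lo (suc (span j₀ s))))
        (beyond-enough (All.map proj₂ (Allₚ.map⁻ (boxes-bounds j₀ s))) p q N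
          (ℤₚ.≤-trans p≤ (d-mono (ℤₚ.i≤i+j lo (+ span j₀ s)))) q≥))

    carrier-output-∷ : carrierOutput (initialCarrier d δ s) (W (Qsym s)) ≡ W (Qsym (T n δ s))
    carrier-output-∷ = conclude (initialSlots-ascending valid lo (span j₀ s)) initialCarrier-frame
                                (time-step valid lo (span j₀ s) (boxes-bounds j₀ s))
      where
      conclude : ∀ {E s'} → Ascending E → Frame E → Carries E s s' →
                 carrierOutput (initialCarrier d δ s) (W (Qsym s)) ≡ W (Qsym s')
      conclude aE (pre , post , refl , pre≤lo) K = carrierOutput-run aC (carries-Qsym aC
        (carries-unframe {pre} {initialCarrier d δ s} {post} K
          (All.map (λ (l , u) → u , All.map (λ z≤lo → ℤₚ.≤-trans z≤lo l) pre≤lo) (boxes-bounds j₀ s))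
          initialCarrier-enough))
        where
        aC : Ascending (initialCarrier d δ s)
        aC = AllPairs-++ˡ (initialCarrier d δ s) (AllPairs-++ʳ pre aE)

  carrier-output : ∀ d → IsSlotBoundary δ d → ∀ s → ValidState n δ s →
                   carrierOutput (initialCarrier d δ s) (W (Qsym s)) ≡ W (Qsym (T n δ s))
  carrier-output d _ [] valid =
    -- For variable `n`, `T n δ []` does not reduce; the run on the empty word shows that its
    -- reading word is empty.
    run-deterministic [] (carries-Qsym (initialSlots-ascending valid (+ 0) 0) (time-step valid (+ 0) 0 []))
  carrier-output d boundary ((j₀ , c₀) ∷ s') valid = carrier-output-∷ d boundary j₀ c₀ s' valid

theorem5p1 : (n : ℕ) (δ : ℤ → ℕ) → (∀ j → δ j ≥ 1) →
    (∀ s → ValidState n δ s → Psym (T n δ s) ≡ Psym s)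
    × (∀ s₁ s₂ → ValidState n δ s₁ → ValidState n δ s₂ →
    Qsym s₁ ≡ Qsym s₂ → Qsym (T n δ s₁) ≡ Qsym (T n δ s₂))
    × (∀ (d : ℤ → ℤ) → IsSlotBoundary δ d → ∀ s → ValidState n δ s →
    carrierOutput (initialCarrier d δ s) (W (Qsym s)) ≡ W (Qsym (T n δ s)))
theorem5p1 n δ δ≥1 = P-conserved n δ δ≥1 , Q-autonomous n δ δ≥1 , carrier-output n δ δ≥1
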